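{- Let $\mathcal{L}$ be the category whose objects are natural numbers and whose morphisms $m\to n$ are the total injective increasing functions $[m]\to[n]$, and let $\mathcal{P}$ be its free conservative finite cocompletion. Then $\mathcal{P}$ is equivalent to the full subcategory of the category of graphs whose objects are the finite graphs such that for every non-empty path from a vertex $x$ to a vertex $y$ there exists exactly one edge $x\to y$. Equivalently, $\mathcal{P}$ is equivalent to the category whose objects are finite sets equipped with a transitive relation $<$, and whose morphisms are the functions $f$ respecting the relations (i.e. $a<a'$ implies $f(a)<f(a')$).
   Context: For $n\in\mathbb{N}$ write $[n]=\{0,\dots,n-1\}$. A graph consists of a set of vertices, a set of edges, and source and target functions from edges to vertices; morphisms of graphs are pairs of functions on vertices and edges commuting with source and target. A path of length $k\ge1$ from $x$ to $y$ is a sequence of $k$ edges, each one's target being the next one's source, starting at $x$ and ending at $y$. The free conservative finite cocompletion of $\mathcal{L}$ is (up to equivalence) the unique finitely cocomplete category $\mathcal{P}$ together with an embedding functor $y:\mathcal{L}\to\mathcal{P}$ preserving those finite colimits which exist in $\mathcal{L}$, such that for every finitely cocomplete category $\mathcal{C}$ and every functor $F:\mathcal{L}\to\mathcal{C}$ preserving the finite colimits existing in $\mathcal{L}$, there is, up to unique isomorphism, a unique finite-colimit-preserving functor $\tilde F:\mathcal{P}\to\mathcal{C}$ with $\tilde F\circ y=F$. -}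

module Defs where

open import Level using (Level; _⊔_; 0ℓ; Setω) renaming (suc to lsuc)
open import Data.Nat using (ℕ)
open import Data.Fin using (Fin; _<_)
open import Data.Bool using (Bool; T)
open import Data.Product using (Σ; _×_; _,_; proj₁; proj₂)
open import Relation.Binary using (Rel; IsEquivalence)
open import Relation.Binary.PropositionalEquality as P using (_≡_; refl; cong)

-- Categories with setoid-valued hom sets (no function extensionality
-- is available, so morphism equality is an explicit equivalence).

record Category (o ℓ e : Level) : Set (lsuc (o ⊔ ℓ ⊔ e)) where
  infixr 9 _∘_
  infix  4 _≈_
  field
    Obj      : Set o
    _⇒_      : Obj → Obj → Set ℓ
    _≈_      : ∀ {A B} → Rel (A ⇒ B) e
    id       : ∀ {A} → A ⇒ A
    _∘_      : ∀ {A B C} → B ⇒ C → A ⇒ B → A ⇒ C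
    ≈-equiv  : ∀ {A B} → IsEquivalence (_≈_ {A} {B})
    ∘-resp-≈ : ∀ {A B C} {f h : B ⇒ C} {g i : A ⇒ B} → f ≈ h → g ≈ i → f ∘ g ≈ h ∘ i
    identityˡ : ∀ {A B} {f : A ⇒ B} → id ∘ f ≈ f
    identityʳ : ∀ {A B} {f : A ⇒ B} → f ∘ id ≈ f
    assoc    : ∀ {A B C D} {f : A ⇒ B} {g : B ⇒ C} {h : C ⇒ D} → (h ∘ g) ∘ f ≈ h ∘ (g ∘ f)

  ≈-sym : ∀ {A B} {f g : A ⇒ B} → f ≈ g → g ≈ f
  ≈-sym = IsEquivalence.sym ≈-equiv

  ≈-trans : ∀ {A B} {f g h : A ⇒ B} → f ≈ g → g ≈ h → f ≈ h
  ≈-trans = IsEquivalence.trans ≈-equiv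

open Category

record Functor {o ℓ e o' ℓ' e'} (C : Category o ℓ e) (D : Category o' ℓ' e')
       : Set (o ⊔ ℓ ⊔ e ⊔ o' ⊔ ℓ' ⊔ e') where
  field
    F₀ : Obj C → Obj D
    F₁ : ∀ {A B} → _⇒_ C A B → _⇒_ D (F₀ A) (F₀ B)
    F-resp-≈ : ∀ {A B} {f g : _⇒_ C A B} → _≈_ C f g → _≈_ D (F₁ f) (F₁ g)
    F-id : ∀ {A} → _≈_ D (F₁ (id C {A})) (id D)
    F-∘  : ∀ {A B X} {f : _⇒_ C A B} {g : _⇒_ C B X} →
           _≈_ D (F₁ (_∘_ C g f)) (_∘_ D (F₁ g) (F₁ f))

open Functor

idF : ∀ {o ℓ e} (C : Category o ℓ e) → Functor C C
idF C = record
  { F₀ = λ A → A ; F₁ = λ f → f ; F-resp-≈ = λ p → p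
  ; F-id = IsEquivalence.refl (≈-equiv C)
  ; F-∘ = IsEquivalence.refl (≈-equiv C) }

_∘F_ : ∀ {o ℓ e o' ℓ' e' o'' ℓ'' e''}
         {C : Category o ℓ e} {D : Category o' ℓ' e'} {E : Category o'' ℓ'' e''} →
       Functor D E → Functor C D → Functor C E
_∘F_ {E = E} G F = record
  { F₀ = λ A → F₀ G (F₀ F A)
  ; F₁ = λ f → F₁ G (F₁ F f)
  ; F-resp-≈ = λ p → F-resp-≈ G (F-resp-≈ F p)
  ; F-id = ≈-trans E (F-resp-≈ G (F-id F)) (F-id G)
  ; F-∘ = ≈-trans E (F-resp-≈ G (F-∘ F)) (F-∘ G) }

record NatIso {o ℓ e o' ℓ' e'} {C : Category o ℓ e} {D : Category o' ℓ' e'}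
              (F G : Functor C D) : Set (o ⊔ ℓ ⊔ ℓ' ⊔ e') where
  field
    η    : ∀ A → _⇒_ D (F₀ F A) (F₀ G A)
    η⁻¹  : ∀ A → _⇒_ D (F₀ G A) (F₀ F A)
    isoˡ : ∀ A → _≈_ D (_∘_ D (η⁻¹ A) (η A)) (id D)
    isoʳ : ∀ A → _≈_ D (_∘_ D (η A) (η⁻¹ A)) (id D)
    natural : ∀ {A B} (f : _⇒_ C A B) →
              _≈_ D (_∘_ D (η B) (F₁ F f)) (_∘_ D (F₁ G f) (η A))

open NatIso

record Equivalence {o ℓ e o' ℓ' e'} (C : Category o ℓ e) (D : Category o' ℓ' e')
       : Set (o ⊔ ℓ ⊔ e ⊔ o' ⊔ ℓ' ⊔ e') where
  field
    F : Functor C D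
    G : Functor D C
    unit   : NatIso (G ∘F F) (idF C)
    counit : NatIso (F ∘F G) (idF D)

FullyFaithful : ∀ {o ℓ e o' ℓ' e'} {C : Category o ℓ e} {D : Category o' ℓ' e'} →
                Functor C D → Set (o ⊔ ℓ ⊔ e ⊔ ℓ' ⊔ e')
FullyFaithful {C = C} {D} F =
  (∀ {A B} (h : _⇒_ D (F₀ F A) (F₀ F B)) → Σ (_⇒_ C A B) λ f → _≈_ D (F₁ F f) h)
  × (∀ {A B} (f g : _⇒_ C A B) → _≈_ D (F₁ F f) (F₁ F g) → _≈_ C f g)

-- Finite colimits.  Diagram shapes are finite graphs (Fin-indexed
-- vertices and edges); colimits of finite-graph-shaped diagrams are
-- exactly the finite colimits.

record Shape : Set where
  field
    nV nE : ℕ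
    s t   : Fin nE → Fin nV

open Shape

record Diagram {o ℓ e} (C : Category o ℓ e) (Γ : Shape) : Set (o ⊔ ℓ) where
  field
    obj : Fin (nV Γ) → Obj C
    arr : (k : Fin (nE Γ)) → _⇒_ C (obj (s Γ k)) (obj (t Γ k))

open Diagram

record Cocone {o ℓ e} {C : Category o ℓ e} {Γ : Shape} (D : Diagram C Γ)
       : Set (o ⊔ ℓ ⊔ e) where
  field
    apex    : Obj C
    leg     : (i : Fin (nV Γ)) → _⇒_ C (obj D i) apex
    commute : (k : Fin (nE Γ)) → _≈_ C (_∘_ C (leg (t Γ k)) (arr D k)) (leg (s Γ k))

open Cocone

IsColimit : ∀ {o ℓ e} {C : Category o ℓ e} {Γ : Shape} {D : Diagram C Γ} →
            Cocone D → Set (o ⊔ ℓ ⊔ e)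
IsColimit {C = C} {Γ} {D} c =
  (c' : Cocone D) →
  Σ (_⇒_ C (apex c) (apex c')) λ u →
    (∀ i → _≈_ C (_∘_ C u (leg c i)) (leg c' i))
    × (∀ (v : _⇒_ C (apex c) (apex c')) →
         (∀ i → _≈_ C (_∘_ C v (leg c i)) (leg c' i)) → _≈_ C v u)

FinitelyCocomplete : ∀ {o ℓ e} → Category o ℓ e → Set (o ⊔ ℓ ⊔ e)
FinitelyCocomplete C = (Γ : Shape) (D : Diagram C Γ) → Σ (Cocone D) IsColimit

mapDiagram : ∀ {o ℓ e o' ℓ' e'} {C : Category o ℓ e} {E : Category o' ℓ' e'} {Γ : Shape} →
             Functor C E → Diagram C Γ → Diagram E Γ
mapDiagram F D = record { obj = λ i → F₀ F (obj D i) ; arr = λ k → F₁ F (arr D k) }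

mapCocone : ∀ {o ℓ e o' ℓ' e'} {C : Category o ℓ e} {E : Category o' ℓ' e'} {Γ : Shape}
              {D : Diagram C Γ} (F : Functor C E) → Cocone D → Cocone (mapDiagram F D)
mapCocone {E = E} F c = record
  { apex = F₀ F (apex c)
  ; leg = λ i → F₁ F (leg c i)
  ; commute = λ k → ≈-trans E (≈-sym E (F-∘ F)) (F-resp-≈ F (commute c k)) }

PreservesFinColimits : ∀ {o ℓ e o' ℓ' e'} {C : Category o ℓ e} {E : Category o' ℓ' e'} →
                       Functor C E → Set (o ⊔ ℓ ⊔ e ⊔ o' ⊔ ℓ' ⊔ e')
PreservesFinColimits {C = C} F =
  (Γ : Shape) (D : Diagram C Γ) (c : Cocone D) → IsColimit c → IsColimit (mapCocone F c)

module _ {o ℓ e oP ℓP eP} (L : Category o ℓ e) (Pc : Category oP ℓP eP)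
         (y : Functor L Pc) where

  UniversalAt : (o' ℓ' e' : Level) →
                Set (lsuc (o' ⊔ ℓ' ⊔ e') ⊔ o ⊔ ℓ ⊔ e ⊔ oP ⊔ ℓP ⊔ eP)
  UniversalAt o' ℓ' e' =
    (E : Category o' ℓ' e') → FinitelyCocomplete E →
    (F : Functor L E) → PreservesFinColimits F →
    Σ (Functor Pc E) (λ F̃ → PreservesFinColimits F̃ × NatIso (F̃ ∘F y) F)
    × ((G G' : Functor Pc E) → PreservesFinColimits G → PreservesFinColimits G' →
       (α : NatIso (G ∘F y) F) (α' : NatIso (G' ∘F y) F) →
       Σ (NatIso G G') λ θ →
         (∀ A → _≈_ E (_∘_ E (η α' A) (η θ (F₀ y A))) (η α A))
         × ((θ' : NatIso G G') →
            (∀ A → _≈_ E (_∘_ E (η α' A) (η θ' (F₀ y A))) (η α A)) →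
            ∀ X → _≈_ E (η θ' X) (η θ X)))

  record IsFreeConsFinCocompletion : Setω where
    field
      cocomplete  : FinitelyCocomplete Pc
      embedding   : FullyFaithful y
      preserves   : PreservesFinColimits y
      universal   : (o' ℓ' e' : Level) → UniversalAt o' ℓ' e'

-- The category 𝓛: objects ℕ, morphisms m → n the (total) injective
-- increasing maps [m] → [n], i.e. strictly increasing maps Fin m → Fin n.

record IncMap (m n : ℕ) : Set where
  constructor incMap
  field
    fun  : Fin m → Fin n
    mono : ∀ {i j : Fin m} → i < j → fun i < fun j

open IncMap

𝓛 : Category 0ℓ 0ℓ 0ℓ
𝓛 = record
  { Obj = ℕ
  ; _⇒_ = IncMap
  ; _≈_ = λ f g → ∀ i → fun f i ≡ fun g i
  ; id = incMap (λ i → i) (λ p → p)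
  ; _∘_ = λ g f → incMap (λ i → fun g (fun f i)) (λ p → mono g (mono f p))
  ; ≈-equiv = record { refl = λ _ → refl ; sym = λ p i → P.sym (p i)
                     ; trans = λ p q i → P.trans (p i) (q i) }
  ; ∘-resp-≈ = λ {_} {_} {_} {f} {h} {g} {i} p q x → P.trans (cong (fun f) (q x)) (p (fun i x))
  ; identityˡ = λ _ → refl
  ; identityʳ = λ _ → refl
  ; assoc = λ _ → refl }

record FinGraph : Set where
  field
    nV nE : ℕ
    src tgt : Fin nE → Fin nV

open FinGraph

record GraphHom (G H : FinGraph) : Set where
  field
    fV : Fin (nV G) → Fin (nV H)
    fE : Fin (nE G) → Fin (nE H)
    src-comm : ∀ a → src H (fE a) ≡ fV (src G a)
    tgt-comm : ∀ a → tgt H (fE a) ≡ fV (tgt G a)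

open GraphHom

data Path (G : FinGraph) : Fin (nV G) → Fin (nV G) → Set where
  edge : (a : Fin (nE G)) → Path G (src G a) (tgt G a)
  _∷_  : (a : Fin (nE G)) {y : Fin (nV G)} → Path G (tgt G a) y → Path G (src G a) y

PathCondition : FinGraph → Set
PathCondition G =
  ∀ x y → Path G x y →
  Σ (Fin (nE G)) λ a → (src G a ≡ x × tgt G a ≡ y)
    × (∀ b → src G b ≡ x → tgt G b ≡ y → b ≡ a)

𝓖 : Category 0ℓ 0ℓ 0ℓ
𝓖 = record
  { Obj = Σ FinGraph PathCondition
  ; _⇒_ = λ G H → GraphHom (proj₁ G) (proj₁ H)
  ; _≈_ = λ f g → (∀ v → fV f v ≡ fV g v) × (∀ a → fE f a ≡ fE g a)
  ; id = record { fV = λ v → v ; fE = λ a → a ; src-comm = λ _ → refl ; tgt-comm = λ _ → refl }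
  ; _∘_ = λ g f → record
      { fV = λ v → fV g (fV f v) ; fE = λ a → fE g (fE f a)
      ; src-comm = λ a → P.trans (src-comm g (fE f a)) (cong (fV g) (src-comm f a))
      ; tgt-comm = λ a → P.trans (tgt-comm g (fE f a)) (cong (fV g) (tgt-comm f a)) }
  ; ≈-equiv = record
      { refl = (λ _ → refl) , (λ _ → refl)
      ; sym = λ p → (λ v → P.sym (proj₁ p v)) , (λ a → P.sym (proj₂ p a))
      ; trans = λ p q → (λ v → P.trans (proj₁ p v) (proj₁ q v)) , (λ a → P.trans (proj₂ p a) (proj₂ q a)) }
  ; ∘-resp-≈ = λ {_} {_} {_} {f} {h} {g} {i} p q →
      (λ v → P.trans (cong (fV f) (proj₁ q v)) (proj₁ p (fV i v))) ,
      (λ a → P.trans (cong (fE f) (proj₂ q a)) (proj₂ p (fE i a)))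
  ; identityˡ = (λ _ → refl) , (λ _ → refl)
  ; identityʳ = (λ _ → refl) , (λ _ → refl)
  ; assoc = (λ _ → refl) , (λ _ → refl) }

record TransRel : Set where
  field
    size : ℕ
    rel  : Fin size → Fin size → Bool
    trans : ∀ {a b c} → T (rel a b) → T (rel b c) → T (rel a c)

open TransRel

record RelHom (A B : TransRel) : Set where
  field
    map  : Fin (size A) → Fin (size B)
    resp : ∀ {a a'} → T (rel A a a') → T (rel B (map a) (map a'))

open RelHom

𝓣 : Category 0ℓ 0ℓ 0ℓ
𝓣 = record
  { Obj = TransRel
  ; _⇒_ = RelHom
  ; _≈_ = λ f g → ∀ a → map f a ≡ map g a
  ; id = record { map = λ a → a ; resp = λ p → p }
  ; _∘_ = λ g f → record { map = λ a → map g (map f a) ; resp = λ p → resp g (resp f p) }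
  ; ≈-equiv = record { refl = λ _ → refl ; sym = λ p i → P.sym (p i)
                     ; trans = λ p q i → P.trans (p i) (q i) }
  ; ∘-resp-≈ = λ {_} {_} {_} {f} {h} {g} {i} p q x → P.trans (cong (map f) (q x)) (p (map i x))
  ; identityˡ = λ _ → refl
  ; identityʳ = λ _ → refl
  ; assoc = λ _ → refl }

{-# OPTIONS --safe #-}
module Submission where

-- A functor F on 𝓛 that preserves the colimits of 𝓛 turns every object X of its
-- target into a set of points F 1 → X with a transitive relation "some segment
-- F 2 → X runs from x to y": two parallel segments have colimit 2 and two
-- consecutive ones have colimit 3, so segments are determined by their endpoints
-- and compose.  The object freely generated by points indexed by a finite
-- transitive relation, with a segment for each related pair, is a finite colimit
-- of copies of F 1 and F 2; this gives the essentially unique cocontinuous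
-- extension of F from 𝓣.  Moreover 𝓣 is finitely cocomplete, and 𝓛 → 𝓣 preserves
-- colimits because a finite strict order all of whose strictly monotone maps into
-- finite chains factor through one of them must be total.  Hence the universal
-- properties of 𝓣 and of the given completion yield mutually inverse functors.

open import Defs
open import Level using (Level; _⊔_; 0ℓ) renaming (suc to lsuc)
open import Data.Bool using (Bool; false; true; T; _∨_; _∧_)
open import Data.Bool.Properties using (T-∨; T-∧; T-≡; T-irrelevant; T?)
open import Data.Empty using (⊥; ⊥-elim)
open import Data.Fin as Fin
  using (Fin; zero; suc; punchIn; punchOut; inject₁; fromℕ<; splitAt; join; _<_; _<?_; _≟_)
open import Data.Fin.Properties
  using (punchInᵢ≢i; punchOut-punchIn; punchIn-punchOut; punchOut-cong; punchIn-injective;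
         punchIn-mono-≤; suc-injective; ≤∧≢⇒<; <⇒≢; <-trans; <-irrefl; <-cmp; <-asym; toℕ-fromℕ<;
         any?; splitAt-join; join-splitAt)
open import Data.Fin.Subset using (Subset) renaming (_∈_ to _∈ˢ_)
open import Data.Fin.Subset.Properties using (p⊂q⇒∣p∣<∣q∣; ∣p∣≤n)
open import Data.List as List using (List; []; _∷_; _++_; concatMap; lookup; length; allFin)
open import Data.List.Membership.Propositional using (_∈_; lose)
open import Data.List.Membership.Propositional.Properties
  using (∈-map⁺; ∈-map⁻; ∈-++⁺ˡ; ∈-++⁺ʳ; ∈-++⁻; ∈-concatMap⁺; ∈-allFin)
open import Data.List.Relation.Unary.Any using (here; there; index)
open import Data.List.Relation.Unary.Any.Properties using (lookup-index)
open import Data.Nat as ℕ using (ℕ; zero; suc; s≤s; z≤n)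
open import Data.Nat.Properties using (<⇒≤)
open import Data.Product using (Σ; _×_; _,_; proj₁; proj₂)
open import Data.Sum using (_⊎_; inj₁; inj₂)
open import Data.Unit using (tt)
open import Data.Vec using (tabulate)
open import Data.Vec.Properties using (lookup∘tabulate; lookup⇒[]=; []=⇒lookup)
open import Function using (_∘_)
open import Function.Bundles using () renaming (module Equivalence to Iff)
open import Relation.Nullary using (¬_; Dec; yes; no)
open import Relation.Nullary.Decidable using (⌊_⌋; toWitness; fromWitness; _⊎-dec_; _×-dec_)
open import Relation.Binary using (Rel; IsEquivalence; Transitive; Tri; tri<; tri≈; tri>)
open import Relation.Binary.Construct.Closure.Equivalence as EqC using (EqClosure)
open import Relation.Binary.PropositionalEquality as P
  using (_≡_; _≢_; refl; cong; subst; subst₂)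

-- Finite quotients and finite colimits in 𝓣

-- Repetitions are allowed, so listing a dependent sum needs no equality test; `quotient` identifies
-- them.
Listing : ∀ {a} → Set a → Set a
Listing A = Σ (List A) λ xs → ∀ x → x ∈ xs

listFin : ∀ n → Listing (Fin n)
listFin n = allFin n , ∈-allFin

listT : ∀ b → Listing (T b)
listT false = [] , λ ()
listT true  = tt ∷ [] , λ _ → here refl

listΣ : {A : Set} {B : A → Set} → Listing A → (∀ x → Listing (B x)) → Listing (Σ A B)
listΣ {A} {B} (xs , all) ys = concatMap row xs , λ (x , y) →
  ∈-concatMap⁺ row (lose (all x) (∈-map⁺ (x ,_) (proj₂ (ys x) y)))
  where
  row : A → List (Σ A B)
  row x = List.map (x ,_) (proj₁ (ys x))

-- A quotient is presented by a map onto Fin card together with a choice of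
-- representatives, so that maps out of it are maps on representatives.
record Quotient {A : Set} (R : Rel A 0ℓ) : Set where
  field
    card   : ℕ
    cls    : A → Fin card
    rep    : Fin card → A
    cls-rep : ∀ c → cls (rep c) ≡ c
    cls-resp : ∀ {x y} → R x y → cls x ≡ cls y
    rep-cls : ∀ x → EqClosure R (rep (cls x)) x

module _ {N : ℕ} where

  Equations : List (Fin N × Fin N) → Rel (Fin N) 0ℓ
  Equations xs a b = (a , b) ∈ xs

  -- One step of merging classes. `extend` takes the fields of `Q` separately so that the number of
  -- classes can be matched as a successor before one of them is removed.
  addEquation : ∀ a b {xs} → Quotient (Equations xs) → Quotient (Equations ((a , b) ∷ xs))
  addEquation a b {xs} Q = extend card cls rep cls-rep cls-resp (EqC.map there ∘ rep-cls)
    where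
    open Quotient Q
    R : Rel (Fin N) 0ℓ
    R = Equations ((a , b) ∷ xs)
    open IsEquivalence (EqC.isEquivalence R) using (sym; trans)

    -- If a and b lie in different classes, the class of b is removed and
    -- sent to the class of a.
    extend : ∀ n (q : Fin N → Fin n) (s : Fin n → Fin N) → (∀ c → q (s c) ≡ c) →
             (∀ {x y} → Equations xs x y → q x ≡ q y) → (∀ x → EqClosure R (s (q x)) x) →
             Quotient R
    extend zero q s qs resp sq with q a
    ... | ()
    extend (suc n) q s qs resp sq with q b ≟ q a
    ... | yes e = record
      { card = suc n ; cls = q ; rep = s ; cls-rep = qs
      ; cls-resp = λ { (here refl) → P.sym e ; (there r) → resp r } ; rep-cls = sq }
    ... | no b≢a = record
      { card = n ; cls = merge ∘ q ; rep = s ∘ punchIn (q b)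
      ; cls-rep = λ c → P.trans (cong merge (qs (punchIn (q b) c))) (merge-punchIn c)
      ; cls-resp = λ { (here refl) → P.trans merge-a (P.sym merge-b) ; (there r) → cong merge (resp r) }
      ; rep-cls = λ x → rep-merge (q x) (sq x) }
      where
      merge : Fin (suc n) → Fin n
      merge x with q b ≟ x
      ... | yes _   = punchOut b≢a
      ... | no  b≢x = punchOut b≢x

      merge-punchIn : ∀ c → merge (punchIn (q b) c) ≡ c
      merge-punchIn c with q b ≟ punchIn (q b) c
      ... | yes e = ⊥-elim (punchInᵢ≢i (q b) c (P.sym e))
      ... | no ¬e = P.trans (punchOut-cong (q b) refl) (punchOut-punchIn (q b))

      merge-a : merge (q a) ≡ punchOut b≢a
      merge-a with q b ≟ q a
      ... | yes _ = refl
      ... | no _  = punchOut-cong (q b) refl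

      merge-b : merge (q b) ≡ punchOut b≢a
      merge-b with q b ≟ q b
      ... | yes _ = refl
      ... | no ¬e = ⊥-elim (¬e refl)

      rep-merge : ∀ c {x} → EqClosure R (s c) x → EqClosure R (s (punchIn (q b) (merge c))) x
      rep-merge c {x} r with q b ≟ c
      ... | no b≢c = subst (λ z → EqClosure R (s z) x) (P.sym (punchIn-punchOut b≢c)) r
      -- The chain leads from the representative of the class of `a` to `a`, across the new equation
      -- to `b`, to the old representative of its class, and on to `x`.
      ... | yes refl = subst (λ z → EqClosure R (s z) x) (P.sym (punchIn-punchOut b≢a))
        (trans (sq a) (trans (EqC.return (here refl)) (trans (sym (sq b)) r)))

  quotientFin : ∀ xs → Quotient (Equations xs)
  quotientFin [] = record
    { card = N ; cls = λ x → x ; rep = λ x → x ; cls-rep = λ _ → refl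
    ; cls-resp = λ () ; rep-cls = λ _ → EqC.reflexive _ }
  quotientFin ((a , b) ∷ xs) = addEquation a b (quotientFin xs)

data Glue {A I : Set} (l r : I → A) : Rel A 0ℓ where
  glue : ∀ i → Glue l r (l i) (r i)

abstract
  -- Classes are formed on positions in the listing, where `quotientFin` applies; each element
  -- stands at the position at which `all` finds it.
  quotient : {A I : Set} → Listing A → Listing I → (l r : I → A) → Quotient (Glue l r)
  quotient {A} {I} (xs , all) (is , allI) l r = record
    { card = card ; cls = cls ∘ pos ; rep = lookup xs ∘ rep
    ; cls-rep = λ c → P.trans
        (cls-resp (∈-++⁺ʳ glued (∈-map⁺ (λ x → pos (lookup xs x) , x) (∈-allFin (rep c)))))
        (cls-rep c)
    ; cls-resp = λ { (glue i) → cls-resp (∈-++⁺ˡ (∈-map⁺ (λ i → pos (l i) , pos (r i)) (allI i))) }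
    ; rep-cls = λ x → subst (EqClosure (Glue l r) _) (P.sym (lookup-index (all x)))
        (EqC.gfold (EqC.isEquivalence _) (lookup xs) step (rep-cls (pos x))) }
    where
    pos : A → Fin (length xs)
    pos x = index (all x)

    -- The second block identifies the positions of repeated elements.
    glued repeated : List (Fin (length xs) × Fin (length xs))
    glued    = List.map (λ i → pos (l i) , pos (r i)) is
    repeated = List.map (λ x → pos (lookup xs x) , x) (allFin _)

    open Quotient (quotientFin (glued ++ repeated))

    step : ∀ {x y} → (x , y) ∈ glued ++ repeated → EqClosure (Glue l r) (lookup xs x) (lookup xs y)
    step p with ∈-++⁻ glued p
    ... | inj₁ p₁ with ∈-map⁻ _ p₁
    ...   | i , _ , refl = subst₂ (EqClosure (Glue l r)) (lookup-index (all (l i)))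
                             (lookup-index (all (r i))) (EqC.return (glue i))
    step p | inj₂ p₂ with ∈-map⁻ _ p₂
    ...   | x , _ , refl = subst (λ z → EqClosure (Glue l r) z (lookup xs x))
                             (lookup-index (all (lookup xs x))) (EqC.reflexive _)

-- Transitive closure of a finite relation

module _ {n : ℕ} where

  record TransOn : Set where
    field
      rel   : Fin n → Fin n → Bool
      trans : ∀ {a b c} → T (rel a b) → T (rel b c) → T (rel a c)

  open TransOn

  module _ (X : TransOn) (a b : Fin n) where

    below : Fin n → Fin n → Bool
    below x y = ⌊ x ≟ y ⌋ ∨ rel X x y

    -- The least transitive relation containing `X` and the pair `a`, `b`: a new step enters at or
    -- below `a` and leaves at or above `b`.
    addedRel : Fin n → Fin n → Bool
    addedRel x y = rel X x y ∨ (below x a ∧ below b y)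

    Below : Fin n → Fin n → Set
    Below x y = x ≡ y ⊎ T (rel X x y)

    below⇒ : ∀ {x y} → T (below x y) → Below x y
    below⇒ p with Iff.to T-∨ p
    ... | inj₁ e = inj₁ (toWitness e)
    ... | inj₂ r = inj₂ r

    ⇒below : ∀ {x y} → Below x y → T (below x y)
    ⇒below {x} {y} (inj₁ e) = Iff.from (T-∨ {⌊ x ≟ y ⌋}) (inj₁ (fromWitness {a? = x ≟ y} e))
    ⇒below {x} {y} (inj₂ r) = Iff.from (T-∨ {⌊ x ≟ y ⌋}) (inj₂ r)

    added⇒ : ∀ {x y} → T (addedRel x y) → T (rel X x y) ⊎ (Below x a × Below b y)
    added⇒ p with Iff.to T-∨ p
    ... | inj₁ r = inj₁ r
    ... | inj₂ q with Iff.to T-∧ q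
    ...   | u , v = inj₂ (below⇒ u , below⇒ v)

    ⇒added : ∀ {x y} → T (rel X x y) ⊎ (Below x a × Below b y) → T (addedRel x y)
    ⇒added (inj₁ r) = Iff.from T-∨ (inj₁ r)
    ⇒added (inj₂ (u , v)) = Iff.from T-∨ (inj₂ (Iff.from T-∧ (⇒below u , ⇒below v)))

    rel-below : ∀ {x y z} → T (rel X x y) → Below y z → Below x z
    rel-below r (inj₁ refl) = inj₂ r
    rel-below r (inj₂ s)    = inj₂ (trans X r s)

    below-rel : ∀ {x y z} → Below x y → T (rel X y z) → Below x z
    below-rel (inj₁ refl) s = inj₂ s
    below-rel (inj₂ r)    s = inj₂ (trans X r s)

    addRel : TransOn
    addRel = record { rel = addedRel ; trans = λ p q → ⇒added (comp (added⇒ p) (added⇒ q)) }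
      where
      comp : ∀ {x y z} → T (rel X x y) ⊎ (Below x a × Below b y) →
             T (rel X y z) ⊎ (Below y a × Below b z) → T (rel X x z) ⊎ (Below x a × Below b z)
      comp (inj₁ r) (inj₁ s)             = inj₁ (trans X r s)
      comp (inj₁ r) (inj₂ (u , v))       = inj₂ (rel-below r u , v)
      comp (inj₂ (u , v)) (inj₁ s)       = inj₂ (u , below-rel v s)
      -- Two passes through the new pair shorten to one, with the entry of the first and the exit of
      -- the second.
      comp (inj₂ (u , _)) (inj₂ (_ , v)) = inj₂ (u , v)

  relClosure : List (Fin n × Fin n) → TransOn
  relClosure []             = record { rel = λ _ _ → false ; trans = λ () }
  relClosure ((a , b) ∷ xs) = addRel (relClosure xs) a b

  relClosure-∋ : ∀ {xs a b} → (a , b) ∈ xs → T (rel (relClosure xs) a b)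
  relClosure-∋ {(a , b) ∷ xs} (here refl) =
    ⇒added (relClosure xs) a b (inj₂ (inj₁ refl , inj₁ refl))
  relClosure-∋ {(a , b) ∷ xs} (there p) = ⇒added (relClosure xs) a b (inj₁ (relClosure-∋ p))

  addRel-elim : ∀ {ℓ} {R : Rel (Fin n) ℓ} → Transitive R → ∀ X a b →
                (∀ {x y} → T (rel X x y) → R x y) → R a b →
                ∀ {x y} → T (addedRel X a b x y) → R x y
  addRel-elim {R = R} tr X a b f ab p with added⇒ X a b p
  ... | inj₁ r       = f r
  ... | inj₂ (u , v) = right v (left u)
    where
    left : ∀ {x} → Below X a b x a → R x b
    left (inj₁ refl) = ab
    left (inj₂ r)    = tr (f r) ab
    right : ∀ {x y} → Below X a b b y → R x b → R x y
    right (inj₁ refl) q = q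
    right (inj₂ r)    q = tr q (f r)

  -- Leastness of the closure. `R` is a relation at any level, not a boolean one, since it will be
  -- pulled back from the links of an object in an arbitrary category.
  relClosure-elim : ∀ {ℓ} {R : Rel (Fin n) ℓ} → Transitive R → ∀ xs →
                    (∀ {x y} → (x , y) ∈ xs → R x y) →
                    ∀ {x y} → T (rel (relClosure xs) x y) → R x y
  relClosure-elim tr ((a , b) ∷ xs) f =
    addRel-elim tr (relClosure xs) a b (relClosure-elim tr xs (f ∘ there)) (f (here refl))

toTransRel : ∀ {n} → TransOn {n} → TransRel
toTransRel {n} X = record { size = n ; rel = TransOn.rel X ; trans = TransOn.trans X }

-- A common generalisation of two receivers of maps out of a colimit in `𝓣`: an object of `𝓣`, and
-- the points of an object of any category with their links. The mediating map is then built once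
-- for both.
record Target (a ℓ r : Level) : Set (lsuc (a ⊔ ℓ ⊔ r)) where
  infix 4 _≈_ _≺_
  field
    Carrier : Set a
    _≈_     : Rel Carrier ℓ
    equiv   : IsEquivalence _≈_
    _≺_     : Rel Carrier r
    ≺-resp  : ∀ {x x' y y'} → x ≈ x' → y ≈ y' → x ≺ y → x' ≺ y'
    ≺-trans : ∀ {x y z} → x ≺ y → y ≺ z → x ≺ z

open TransRel
open RelHom
open IncMap
open Diagram
open Cocone
open Functor
open NatIso

asTarget : TransRel → Target 0ℓ 0ℓ 0ℓ
asTarget X = record
  { Carrier = Fin (size X) ; _≈_ = _≡_ ; equiv = P.isEquivalence ; _≺_ = λ x y → T (rel X x y)
  ; ≺-resp = λ { refl refl r → r } ; ≺-trans = trans X }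

module _ {a ℓ r} (S : Target a ℓ r) where
  open Target S
  open Shape

  Respects : (X : TransRel) → (Fin (size X) → Carrier) → Set r
  Respects X f = ∀ {x y} → T (rel X x y) → f x ≺ f y

  record CoconeTo {Γ : Shape} (D : Diagram 𝓣 Γ) : Set (a ⊔ ℓ ⊔ r) where
    field
      leg      : ∀ i → Fin (size (obj D i)) → Carrier
      respects : ∀ i → Respects (obj D i) (leg i)
      commutes : ∀ k x → leg (t Γ k) (map (arr D k) x) ≈ leg (s Γ k) x

-- The underlying set is the colimit of the finite sets, and the relation is the transitive closure
-- of the images of all related pairs.
module Colimit𝓣 {Γ : Shape} (D : Diagram 𝓣 Γ) where
  open Shape

  Element : Set
  Element = Σ (Fin (nV Γ)) λ i → Fin (size (obj D i))

  source target : (Σ (Fin (nE Γ)) λ k → Fin (size (obj D (s Γ k)))) → Element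
  source (k , x) = s Γ k , x
  target (k , x) = t Γ k , map (arr D k) x

  RelatedPair : Set
  RelatedPair = Σ (Fin (nV Γ)) λ i → Σ (Fin (size (obj D i))) λ x →
                Σ (Fin (size (obj D i))) λ y → T (rel (obj D i) x y)

  private
    Q : Quotient (Glue target source)
    Q = quotient (listΣ (listFin _) λ _ → listFin _) (listΣ (listFin _) λ _ → listFin _) target source

    abstract
      related : Listing RelatedPair
      related = listΣ (listFin _) λ i → listΣ (listFin _) λ x → listΣ (listFin _) λ y → listT _

  open Quotient Q public

  relatedClasses : RelatedPair → Fin card × Fin card
  relatedClasses (i , x , y , _) = cls (i , x) , cls (i , y)

  pairs : List (Fin card × Fin card)
  pairs = List.map relatedClasses (proj₁ related)

  colimit : TransRel
  colimit = toTransRel (relClosure pairs)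

  inject : ∀ i → RelHom (obj D i) colimit
  inject i = record
    { map  = λ x → cls (i , x)
    ; resp = λ {x} {y} r → relClosure-∋ (∈-map⁺ relatedClasses (proj₂ related (i , x , y , r))) }

  cocone : Cocone D
  cocone = record { apex = colimit ; leg = inject ; commute = λ k x → cls-resp (glue (k , x)) }

  module _ {a ℓ r} (S : Target a ℓ r) (c : CoconeTo S D) where
    open Target S
    open CoconeTo c renaming (leg to leg')

    onElement : Element → Carrier
    onElement (i , x) = leg' i x

    mediate : Fin card → Carrier
    mediate z = onElement (rep z)

    -- The representative of a class is joined to `x` by a chain of gluings, and the cocone agrees
    -- along each of them.
    mediate-cls : ∀ x → mediate (cls x) ≈ onElement x
    mediate-cls x = EqC.gfold equiv onElement (λ { (glue (k , x)) → commutes k x }) (rep-cls x)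

    mediate-respects : Respects S colimit mediate
    mediate-respects = relClosure-elim {R = λ x y → mediate x ≺ mediate y} ≺-trans pairs step
      where
      step : ∀ {x y} → (x , y) ∈ pairs → mediate x ≺ mediate y
      step p with ∈-map⁻ relatedClasses p
      ... | (i , x , y , xy) , _ , refl =
        ≺-resp (IsEquivalence.sym equiv (mediate-cls (i , x)))
               (IsEquivalence.sym equiv (mediate-cls (i , y))) (respects i xy)

  module _ {a ℓ r} (S : Target a ℓ r) where
    open Target S

    agree : (f g : Fin card → Carrier) → (∀ x → f (cls x) ≈ g (cls x)) → ∀ z → f z ≈ g z
    agree f g e z = P.subst (λ z → f z ≈ g z) (cls-rep z) (e (rep z))

  coconeTo : (c : Cocone D) → CoconeTo (asTarget (apex c)) D
  coconeTo c = record
    { leg = λ i → map (leg c i) ; respects = λ i → resp (leg c i) ; commutes = commute c }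

  isColimit : IsColimit cocone
  isColimit c = record { map = mediate S c' ; resp = mediate-respects S c' }
              , (λ i x → mediate-cls S c' (i , x))
              , λ v e → agree S (map v) (mediate S c')
                  λ (i , x) → P.trans (e i x) (P.sym (mediate-cls S c' (i , x)))
    where
    S : Target _ _ _
    S = asTarget (apex c)
    c' : CoconeTo S D
    c' = coconeTo c

𝓣-cocomplete : FinitelyCocomplete 𝓣
𝓣-cocomplete Γ D = Colimit𝓣.cocone D , Colimit𝓣.isColimit D

-- The embedding of 𝓛 in 𝓣

chain : ℕ → TransRel
chain m = record
  { size = m ; rel = λ a b → ⌊ a <? b ⌋
  ; trans = λ p q → fromWitness (<-trans (toWitness p) (toWitness q)) }

y₀ : Functor 𝓛 𝓣
y₀ = record
  { F₀ = chain
  ; F₁ = λ f → record { map = fun f ; resp = λ p → fromWitness (mono f (toWitness p)) }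
  ; F-resp-≈ = λ p → p ; F-id = λ _ → refl ; F-∘ = λ _ → refl }

Irreflexive : ∀ {n} → TransOn {n} → Set
Irreflexive X = ∀ x → ¬ T (TransOn.rel X x x)

module Height {n} (X : TransOn {n}) (irr : Irreflexive X) where
  open TransOn X renaming (rel to rel'; trans to trans')

  down : Fin n → Subset n
  down x = tabulate (λ y → rel' y x)

  ∈down⇒ : ∀ {x y} → y ∈ˢ down x → T (rel' y x)
  ∈down⇒ {x} {y} p = Iff.from T-≡ (P.trans (P.sym (lookup∘tabulate (λ y → rel' y x) y)) ([]=⇒lookup p))

  ⇒∈down : ∀ {x y} → T (rel' y x) → y ∈ˢ down x
  ⇒∈down {x} {y} r = lookup⇒[]= y (down x) (P.trans (lookup∘tabulate (λ y → rel' y x) y) (Iff.to T-≡ r))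

  -- The number of strict predecessors, a value from 0 to `n`.
  height : Fin n → Fin (suc n)
  height x = fromℕ< (s≤s (∣p∣≤n (down x)))

  -- Transitivity gives inclusion of the predecessor sets, and it is proper because `x` precedes `y`
  -- but not itself.
  height-mono : ∀ {x y} → T (rel' x y) → height x < height y
  height-mono {x} {y} r = subst₂ ℕ._<_
    (P.sym (toℕ-fromℕ< (s≤s (∣p∣≤n (down x))))) (P.sym (toℕ-fromℕ< (s≤s (∣p∣≤n (down y)))))
    (p⊂q⇒∣p∣<∣q∣ ((λ p → ⇒∈down (trans' (∈down⇒ p) r)) , x , ⇒∈down r , λ p → irr x (∈down⇒ p)))

punchInMap : ∀ {m} → Fin (suc m) → IncMap m (suc m)
punchInMap i = incMap (punchIn i) λ {a} {b} a<b →
  ≤∧≢⇒< (punchIn-mono-≤ i a b (<⇒≤ a<b)) (λ e → <⇒≢ a<b (punchIn-injective i a b e))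

punchIn-agree : ∀ {m} (j i : Fin m) → i ≢ j → punchIn (suc j) i ≡ punchIn (inject₁ j) i
punchIn-agree zero    zero    i≢j = ⊥-elim (i≢j refl)
punchIn-agree zero    (suc i) i≢j = refl
punchIn-agree (suc j) zero    i≢j = refl
punchIn-agree (suc j) (suc i) i≢j = cong suc (punchIn-agree j i (i≢j ∘ cong suc))

punchIn-differ : ∀ {m} (j : Fin m) → punchIn (suc j) j ≢ punchIn (inject₁ j) j
punchIn-differ zero    ()
punchIn-differ (suc j) e = punchIn-differ j (suc-injective e)

-- The colimit of the same chains computed in `𝓣` has a comparison map `φ` to the apex of `c`. It
-- reflects the order and is bijective, so its inverse `ψ` carries the universal property over to
-- the image of `c`.
module Preserve {Γ : Shape} (D : Diagram 𝓛 Γ) (c : Cocone D) (univ : IsColimit c) where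
  open Colimit𝓣 (mapDiagram y₀ D)

  X : TransOn {card}
  X = relClosure pairs

  φ : RelHom colimit (chain (apex c))
  φ = proj₁ (isColimit (mapCocone y₀ c))

  φ-inject : ∀ i x → map φ (cls (i , x)) ≡ fun (leg c i) x
  φ-inject = proj₁ (proj₂ (isColimit (mapCocone y₀ c)))

  φ-mono : ∀ {a b} → T (rel colimit a b) → map φ a < map φ b
  φ-mono r = toWitness (resp φ r)

  -- Strict monotonicity makes the restrictions of `h` along the injections morphisms of `𝓛`; they
  -- form a cocone, to which universality of `c` applies.
  factor : ∀ {n} (h : Fin card → Fin n) → (∀ {a b} → T (rel colimit a b) → h a < h b) →
           Σ (IncMap (apex c) n) λ u → ∀ z → fun u (map φ z) ≡ h z
  factor {n} h h-mono = u , agree (asTarget (chain n)) (fun u ∘ map φ) h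
      (λ (i , x) → P.trans (cong (fun u) (φ-inject i x)) (proj₁ (proj₂ (univ hc)) i x))
    where
    hc : Cocone D
    hc = record
      { apex = n
      ; leg = λ i → incMap (λ x → h (cls (i , x)))
          (λ p → h-mono (resp (inject i) (fromWitness p)))
      ; commute = λ k x → cong h (commute cocone k x) }
    u : IncMap (apex c) n
    u = proj₁ (univ hc)

  -- When b ≤ a fails, the relation a < b can be forced without creating a
  -- loop, and the resulting height function must factor through φ.
  separate : ∀ a b → ¬ Below X a b b a → map φ a < map φ b
  separate a b b≰a = compare (<-cmp (map φ a) (map φ b))
    where
    irr : Irreflexive (addRel X a b)
    irr x r with added⇒ X a b r
    ... | inj₁ r' = <-irrefl refl (φ-mono r')
    -- A loop through the new pair would put `b` at or below `a`.
    ... | inj₂ (inj₁ refl , v)    = b≰a v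
    ... | inj₂ (inj₂ r' , inj₁ refl) = b≰a (inj₂ r')
    ... | inj₂ (inj₂ r' , inj₂ s) = b≰a (inj₂ (trans colimit s r'))

    open Height (addRel X a b) irr
    u : Σ (IncMap (apex c) (suc card)) λ u → ∀ z → fun u (map φ z) ≡ height z
    u = factor height (λ r → height-mono (⇒added X a b (inj₁ r)))
    below-height : height a < height b
    below-height = height-mono (⇒added X a b (inj₂ (inj₁ refl , inj₁ refl)))

    compare : Tri (map φ a < map φ b) (map φ a ≡ map φ b) (map φ b < map φ a) → map φ a < map φ b
    compare (tri< p _ _) = p
    compare (tri≈ _ e _) = ⊥-elim (<⇒≢ below-height
      (P.trans (P.sym (proj₂ u a)) (P.trans (cong (fun (proj₁ u)) e) (proj₂ u b))))
    compare (tri> _ _ p) = ⊥-elim (<-asym below-height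
      (subst₂ _<_ (proj₂ u b) (proj₂ u a) (mono (proj₁ u) p)))

  below? : ∀ a b → Dec (Below X a b a b)
  below? a b = (a ≟ b) ⊎-dec T? _

  -- If `a` is not at or below `b`, then `separate` with the roles exchanged puts `φ b` strictly
  -- below `φ a`.
  φ-reflects : ∀ a b → map φ a < map φ b → T (rel colimit a b)
  φ-reflects a b p with below? a b
  ... | yes (inj₁ refl) = ⊥-elim (<-irrefl refl p)
  ... | yes (inj₂ r)    = r
  ... | no ¬q           = ⊥-elim (<-asym p (separate b a ¬q))

  φ-injective : ∀ a b → map φ a ≡ map φ b → a ≡ b
  φ-injective a b e with below? a b
  ... | yes (inj₁ a≡b) = a≡b
  ... | yes (inj₂ r)   = ⊥-elim (<⇒≢ (φ-mono r) e)
  ... | no ¬q          = ⊥-elim (<⇒≢ (separate b a ¬q) (P.sym e))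

  -- A point j outside the image could be skipped on either side: the maps
  -- omitting j and j + 1 agree off j.
  φ-surjective : ∀ j → Σ (Fin card) λ z → map φ z ≡ j
  φ-surjective j with any? (λ z → map φ z ≟ j)
  ... | yes p = p
  ... | no ¬p = ⊥-elim (punchIn-differ j (P.trans (uniq (punchInMap (suc j)) agree-off j)
                  (P.sym (uniq (punchInMap (inject₁ j)) (λ _ _ → refl) j))))
    where
    hc : Cocone D
    hc = record
      { apex = suc (apex c) ; leg = λ i → Category._∘_ 𝓛 (punchInMap (inject₁ j)) (leg c i)
      ; commute = λ k x → cong (punchIn (inject₁ j)) (commute c k x) }
    uniq = proj₂ (proj₂ (univ hc))
    agree-off : ∀ i x → punchIn (suc j) (fun (leg c i) x) ≡ punchIn (inject₁ j) (fun (leg c i) x)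
    agree-off i x = punchIn-agree j _ λ e → ¬p (_ , P.trans (φ-inject i x) e)

  ψ : RelHom (chain (apex c)) colimit
  ψ = record
    { map = λ j → proj₁ (φ-surjective j)
    ; resp = λ {i} {j} p → φ-reflects _ _
        (subst₂ _<_ (P.sym (proj₂ (φ-surjective i))) (P.sym (proj₂ (φ-surjective j))) (toWitness p)) }

  preserved : IsColimit (mapCocone y₀ c)
  preserved c' = Category._∘_ 𝓣 w ψ
    , (λ i x → P.trans (cong (map w) (φ-injective _ _
          (P.trans (proj₂ (φ-surjective _)) (P.sym (φ-inject i x))))) (proj₁ (proj₂ (isColimit c')) i x))
    , λ v e j → P.trans (cong (map v) (P.sym (proj₂ (φ-surjective j))))
        (proj₂ (proj₂ (isColimit c')) (Category._∘_ 𝓣 v φ)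
          (λ i x → P.trans (cong (map v) (φ-inject i x)) (e i x)) (proj₁ (φ-surjective j)))
    where
    w : RelHom colimit (apex c')
    w = proj₁ (isColimit c')

y₀-preserves : PreservesFinColimits y₀
y₀-preserves Γ D c univ = Preserve.preserved D c univ

-- Equational reasoning with morphisms

module Hom {o ℓ e} (C : Category o ℓ e) where
  open Category C renaming (_∘_ to _●_) public

  infix  3 _∎
  infixr 2 _≈⟨_⟩_ _≈⟨_⟨_

  ≈-refl : ∀ {A B} {f : A ⇒ B} → f ≈ f
  ≈-refl = IsEquivalence.refl ≈-equiv

  ≈-reflexive : ∀ {A B} {f g : A ⇒ B} → f ≡ g → f ≈ g
  ≈-reflexive refl = ≈-refl

  _≈⟨_⟩_ : ∀ {A B} (f : A ⇒ B) {g h} → f ≈ g → g ≈ h → f ≈ h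
  f ≈⟨ p ⟩ q = ≈-trans p q

  _≈⟨_⟨_ : ∀ {A B} (f : A ⇒ B) {g h} → g ≈ f → g ≈ h → f ≈ h
  f ≈⟨ p ⟨ q = ≈-trans (≈-sym p) q

  _∎ : ∀ {A B} (f : A ⇒ B) → f ≈ f
  f ∎ = ≈-refl

  infix 5 _⟩●_ _●⟨_

  _⟩●_ : ∀ {A B X} {f g : B ⇒ X} → f ≈ g → (h : A ⇒ B) → f ● h ≈ g ● h
  p ⟩● h = ∘-resp-≈ p ≈-refl

  _●⟨_ : ∀ {A B X} (h : B ⇒ X) {f g : A ⇒ B} → f ≈ g → h ● f ≈ h ● g
  h ●⟨ p = ∘-resp-≈ ≈-refl p

  pullˡ : ∀ {A B X Y} {f : X ⇒ Y} {g : B ⇒ X} {h : A ⇒ B} {k : B ⇒ Y} →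
          f ● g ≈ k → f ● (g ● h) ≈ k ● h
  pullˡ p = ≈-trans (≈-sym assoc) (p ⟩● _)

  pullʳ : ∀ {A B X Y} {f : X ⇒ Y} {g : B ⇒ X} {h : A ⇒ B} {k : A ⇒ X} →
          g ● h ≈ k → (f ● g) ● h ≈ f ● k
  pullʳ p = ≈-trans assoc (_ ●⟨ p)

  cancelʳ : ∀ {A B X} {f : B ⇒ X} {g : A ⇒ B} {h : B ⇒ A} → g ● h ≈ id → (f ● g) ● h ≈ f
  cancelʳ p = ≈-trans (pullʳ p) identityʳ

-- Diagrams of vertices and segments

vertex : ∀ {m} → Fin m → IncMap 1 m
vertex a = incMap (λ _ → a) λ { {zero} {zero} () }

segment : ∀ {m} {a b : Fin m} → a < b → IncMap 2 m
segment {m} {a} {b} a<b = incMap pair λ { {zero} {suc zero} _ → a<b ; {suc zero} {suc zero} (s≤s ()) }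
  where
  pair : Fin 2 → Fin m
  pair zero    = a
  pair (suc _) = b

δ₀ δ₁ : IncMap 1 2
δ₀ = vertex zero
δ₁ = vertex (suc zero)

-- A graph becomes a diagram in `𝓛` with a copy of 1 for each vertex and of 2 for each edge; `δ₀`
-- and `δ₁` attach an edge to its source and its target.
module GraphDiagram (Gr : FinGraph) where
  open FinGraph Gr

  Node Arrow : Set
  Node  = Fin nV ⊎ Fin nE
  Arrow = Fin nE ⊎ Fin nE

  ob : Node → ℕ
  ob (inj₁ _) = 1
  ob (inj₂ _) = 2

  dom cod : Arrow → Node
  dom (inj₁ a) = inj₁ (src a)
  dom (inj₂ a) = inj₁ (tgt a)
  cod (inj₁ a) = inj₂ a
  cod (inj₂ a) = inj₂ a

  ar : ∀ z → IncMap (ob (dom z)) (ob (cod z))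
  ar (inj₁ _) = δ₀
  ar (inj₂ _) = δ₁

  node : Fin (nV ℕ.+ nE) → Node
  node = splitAt nV

  arrow : Fin (nE ℕ.+ nE) → Arrow
  arrow = splitAt nE

  code : Node → Fin (nV ℕ.+ nE)
  code = join nV nE

  node-code : ∀ v → node (code v) ≡ v
  node-code = splitAt-join nV nE

  code-node : ∀ i → code (node i) ≡ i
  code-node = join-splitAt nV nE

  -- Decoding a coded node returns it only up to propositional equality, so arrows of the coded
  -- shape are transported. `Legs`, `Commutes` and `Universal` describe cocones over `Node` and
  -- `Arrow` instead, where no transport occurs.
  castArr : ∀ {v v' w w'} → v' ≡ v → w' ≡ w → IncMap (ob v) (ob w) → IncMap (ob v') (ob w')
  castArr refl refl f = f

  shape : Shape
  shape = record
    { nV = nV ℕ.+ nE ; nE = nE ℕ.+ nE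
    ; s = λ k → code (dom (arrow k)) ; t = λ k → code (cod (arrow k)) }

  diagram : Diagram 𝓛 shape
  diagram = record
    { obj = λ i → ob (node i)
    ; arr = λ k → castArr (node-code (dom (arrow k))) (node-code (cod (arrow k))) (ar (arrow k)) }

  module _ {o ℓ e} {E : Category o ℓ e} (F : Functor 𝓛 E) where
    open Hom E

    Legs : Obj → Set ℓ
    Legs X = ∀ v → F₀ F (ob v) ⇒ X

    Commutes : ∀ {X} → Legs X → Set e
    Commutes L = ∀ z → L (cod z) ● F₁ F (ar z) ≈ L (dom z)

    Universal : ∀ {X} → Legs X → Set (o ⊔ ℓ ⊔ e)
    Universal {X} L = ∀ {Y} (L' : Legs Y) → Commutes L' →
      Σ (X ⇒ Y) λ u → (∀ v → u ● L v ≈ L' v) × (∀ w → (∀ v → w ● L v ≈ L' v) → w ≈ u)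

    toCocone : ∀ {X} (L : Legs X) → Commutes L → Cocone (mapDiagram F diagram)
    toCocone {X} L comm = record
      { apex = X ; leg = λ i → L (node i)
      ; commute = λ k → cast (node-code (dom (arrow k))) (node-code (cod (arrow k))) _ (comm (arrow k)) }
      where
      cast : ∀ {v v' w w'} (p : v' ≡ v) (q : w' ≡ w) f →
             L w ● F₁ F f ≈ L v → L w' ● F₁ F (castArr p q f) ≈ L v'
      cast refl refl f c = c

    castLeg : ∀ {v v' X} → v' ≡ v → F₀ F (ob v') ⇒ X → F₀ F (ob v) ⇒ X
    castLeg refl l = l

    fromCocone : (c : Cocone (mapDiagram F diagram)) → Legs (apex c)
    fromCocone c v = castLeg (node-code v) (leg c (code v))

    fromCocone-commutes : (c : Cocone (mapDiagram F diagram)) → Commutes (fromCocone c)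
    fromCocone-commutes c z =
      subst (λ z → fromCocone c (cod z) ● F₁ F (ar z) ≈ fromCocone c (dom z)) (splitAt-join nE nE z)
        (cast (node-code _) (node-code _) (ar (arrow k)) (commute c k))
      where
      k : Fin (nE ℕ.+ nE)
      k = join nE nE z
      cast : ∀ {v v' w w'} (p : v' ≡ v) (q : w' ≡ w) f {l l'} →
             l' ● F₁ F (castArr p q f) ≈ l → castLeg q l' ● F₁ F f ≈ castLeg p l
      cast refl refl f c = c

    fromCocone-node : (c : Cocone (mapDiagram F diagram)) → ∀ i → fromCocone c (node i) ≡ leg c i
    fromCocone-node c i = cast (code-node i) (node-code (node i))
      where
      cast : ∀ {i'} → i' ≡ i → (p : node i' ≡ node i) → castLeg p (leg c i') ≡ leg c i
      cast refl refl = refl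

    fromColimit : (c : Cocone (mapDiagram F diagram)) → IsColimit c → Universal (fromCocone c)
    fromColimit c univ L' comm with univ (toCocone L' comm)
    ... | u , fac , uniq = u , (λ v → cast (node-code v) (fac (code v)))
                         , λ w p → uniq w λ i →
                             subst (λ l → w ● l ≈ L' (node i)) (fromCocone-node c i) (p (node i))
      where
      cast : ∀ {v v' l} (p : v' ≡ v) → u ● l ≈ L' v' → u ● castLeg p l ≈ L' v
      cast refl q = q

    toColimit : ∀ {X} (L : Legs X) (comm : Commutes L) → Universal L → IsColimit (toCocone L comm)
    toColimit L comm univ c with univ (fromCocone c) (fromCocone-commutes c)
    ... | u , fac , uniq = u , (λ i → ≈-trans (fac (node i)) (≈-reflexive (fromCocone-node c i)))
                         , λ w p → uniq w λ v → cast w (node-code v) (p (code v))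
      where
      cast : ∀ w {v v' l} (p : v' ≡ v) → w ● L v' ≈ l → w ● L v ≈ castLeg p l
      cast w refl q = q

  colimitOf : ∀ {o ℓ e} {E : Category o ℓ e} → FinitelyCocomplete E → (F : Functor 𝓛 E) →
              Σ (Category.Obj E) λ X → Σ (Legs F X) λ L → Commutes F L × Universal F L
  colimitOf cocomplete F with cocomplete shape (mapDiagram F diagram)
  ... | c , univ = apex c , fromCocone F c , fromCocone-commutes F c , fromColimit F c univ

  preserveUniversal : ∀ {o ℓ e o' ℓ' e'} {E : Category o ℓ e} {E' : Category o' ℓ' e'}
    (F : Functor 𝓛 E) (K : Functor E E') → PreservesFinColimits K →
    ∀ {X} (L : Legs F X) → Commutes F L → Universal F L →
    Universal (K ∘F F) (λ v → F₁ K (L v))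
  preserveUniversal {E' = E'} F K pres L comm univ L' comm'
    with pres shape (mapDiagram F diagram) (toCocone F L comm) (toColimit F L comm univ)
              (toCocone (K ∘F F) L' comm')
  ... | u , fac , uniq =
        u , (λ v → subst (λ v → u ● F₁ K (L v) ≈ L' v) (node-code v) (fac (code v)))
          , λ w p → uniq w (λ i → p (node i))
    where open Hom E'

  -- Composing legs with `γ` turns cocones for `F'` into cocones for `F`.
  transportUniversal : ∀ {o ℓ e} {E : Category o ℓ e} {F F' : Functor 𝓛 E} (γ : NatIso F F') →
    ∀ {X} (L : Legs F X) → Universal F L →
    Universal F' (λ v → Category._∘_ E (L v) (η⁻¹ γ (ob v)))
  transportUniversal {E = E} {F} {F'} γ L univ L' comm'
    with univ (λ v → Category._∘_ E (L' v) (η γ (ob v))) (λ z → let open Hom E in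
        (L' (cod z) ● η γ (ob (cod z))) ● F₁ F (ar z)   ≈⟨ pullʳ (natural γ (ar z)) ⟩
        L' (cod z) ● (F₁ F' (ar z) ● η γ (ob (dom z)))  ≈⟨ pullˡ (comm' z) ⟩
        L' (dom z) ● η γ (ob (dom z))                   ∎)
  ... | u , fac , uniq =
        u , (λ v → u ● (L v ● η⁻¹ γ (ob v))           ≈⟨ pullˡ (fac v) ⟩
                   (L' v ● η γ (ob v)) ● η⁻¹ γ (ob v) ≈⟨ cancelʳ (isoʳ γ (ob v)) ⟩
                   L' v                               ∎)
          , λ w p → uniq w λ v →
              w ● L v                                   ≈⟨ w ●⟨ cancelʳ (isoˡ γ (ob v)) ⟨
              w ● ((L v ● η⁻¹ γ (ob v)) ● η γ (ob v))   ≈⟨ pullˡ (p v) ⟩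
              L' v ● η γ (ob v)                         ∎
    where open Hom E

  -- The edges generate the whole linear order on the vertices, tested by maps into chains. This is
  -- what makes the chain `nV` the colimit in `𝓛` of its vertices and the given segments.
  Spans : Set
  Spans = ∀ {n} (f : Fin nV → Fin n) → (∀ a → f (src a) < f (tgt a)) →
          ∀ {i j} → i < j → f i < f j

  module Spanning (src<tgt : ∀ a → src a < tgt a) (span : Spans) where

    legs : Legs (idF 𝓛) nV
    legs (inj₁ a) = vertex a
    legs (inj₂ a) = segment (src<tgt a)

    legs-commute : Commutes (idF 𝓛) {nV} legs
    legs-commute (inj₁ a) zero = refl
    legs-commute (inj₂ a) zero = refl

    -- A cocone is determined by the images of the vertices. Its edge legs make this vertex map
    -- increase along edges, hence everywhere by `span`.
    legs-universal : Universal (idF 𝓛) {nV} legs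
    legs-universal {n} L' comm = incMap f (span f f-edge)
      , (λ { (inj₁ a) zero → refl ; (inj₂ a) zero → P.sym (comm (inj₁ a) zero)
           ; (inj₂ a) (suc zero) → P.sym (comm (inj₂ a) zero) })
      , λ w p a → p (inj₁ a) zero
      where
      f : Fin nV → Fin n
      f a = fun (L' (inj₁ a)) zero
      f-edge : ∀ a → f (src a) < f (tgt a)
      f-edge a = subst₂ _<_ (comm (inj₁ a) zero) (comm (inj₂ a) zero)
        (mono (L' (inj₂ a)) {zero} {suc zero} (s≤s z≤n))

-- The graph with one edge for each related pair. A quotient by no equations enumerates these pairs
-- without repetition, so `edgeOf` and `related` are mutually inverse.
module RelGraph (X : TransRel) where

  Related : Set
  Related = Σ (Fin (size X)) λ a → Σ (Fin (size X)) λ b → T (rel X a b)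

  private
    noEquation : ⊥ → Related
    noEquation ()

    Q : Quotient (Glue noEquation noEquation)
    Q = quotient (listΣ (listFin _) λ _ → listΣ (listFin _) λ _ → listT _) ([] , λ ())
          noEquation noEquation

  open Quotient Q public using (card) renaming (cls to edgeOf; rep to related; cls-rep to edgeOf-related)

  related-edgeOf : ∀ r → related (edgeOf r) ≡ r
  related-edgeOf r = EqC.fold P.isEquivalence (λ { (glue ()) }) (Quotient.rep-cls Q r)

  graph : FinGraph
  graph = record
    { nV = size X ; nE = card
    ; src = λ a → proj₁ (related a) ; tgt = λ a → proj₁ (proj₂ (related a)) }

-- Extensions along 𝓛 → 𝓣

module Points {o ℓ e} {E : Category o ℓ e} (F : Functor 𝓛 E) (pres : PreservesFinColimits F) where
  open Hom E

  Point : Obj → Set ℓ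
  Point X = F₀ F 1 ⇒ X

  Link : ∀ {X} → Point X → Point X → Set (ℓ ⊔ e)
  Link {X} x y = Σ (F₀ F 2 ⇒ X) λ h → h ● F₁ F δ₀ ≈ x × h ● F₁ F δ₁ ≈ y

  link-resp : ∀ {X} {x x' y y' : Point X} → x ≈ x' → y ≈ y' → Link x y → Link x' y'
  link-resp p q (h , h₀ , h₁) = h , ≈-trans h₀ p , ≈-trans h₁ q

  link-map : ∀ {X Y} (f : X ⇒ Y) {x y : Point X} → Link x y → Link (f ● x) (f ● y)
  link-map f (h , h₀ , h₁) = f ● h , pullʳ h₀ , pullʳ h₁

  -- In 𝓛 two parallel segments glued along both endpoints have colimit 2.
  link-unique : ∀ {X} {x y : Point X} (l l' : Link x y) → proj₁ l ≈ proj₁ l'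
  link-unique {X} {x} {y} (h , h₀ , h₁) (h' , h₀' , h₁')
    = ≈-trans (≈-sym (fac (inj₂ zero))) (fac (inj₂ (suc zero)))
    where
    parallel : FinGraph
    parallel = record { nV = 2 ; nE = 2 ; src = λ _ → zero ; tgt = λ _ → suc zero }
    open GraphDiagram parallel
    span : Spans
    span f p {zero}     {suc zero} _ = p zero
    span f p {suc zero} {suc zero} (s≤s ())
    src<tgt : ∀ a → FinGraph.src parallel a < FinGraph.tgt parallel a
    src<tgt _ = s≤s z≤n
    open Spanning src<tgt span
    L : Legs F X
    L (inj₁ zero)       = x
    L (inj₁ (suc _))    = y
    L (inj₂ zero)       = h
    L (inj₂ (suc _))    = h'
    L-commutes : Commutes F L
    L-commutes (inj₁ zero)    = h₀
    L-commutes (inj₁ (suc zero)) = h₀'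
    L-commutes (inj₂ zero)    = h₁
    L-commutes (inj₂ (suc zero)) = h₁'
    fac = proj₁ (proj₂ (preserveUniversal (idF 𝓛) F pres legs legs-commute legs-universal L L-commutes))

  -- In 𝓛 two consecutive segments have colimit 3, whose long edge composes them.
  link-trans : ∀ {X} {x y z : Point X} → Link x y → Link y z → Link x z
  link-trans {X} {x} {y} {z} (h , h₀ , h₁) (k , k₀ , k₁)
    = u ● F₁ F long
      , ≈-trans (pullʳ (≈-trans (≈-sym (F-∘ F)) (F-resp-≈ F (λ _ → refl)))) (fac (inj₁ zero))
      , ≈-trans (pullʳ (≈-trans (≈-sym (F-∘ F)) (F-resp-≈ F (λ _ → refl)))) (fac (inj₁ (suc (suc zero))))
    where
    from to : Fin 2 → Fin 3
    from zero    = zero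
    from (suc _) = suc zero
    to zero      = suc zero
    to (suc _)   = suc (suc zero)
    consecutive : FinGraph
    consecutive = record { nV = 3 ; nE = 2 ; src = from ; tgt = to }
    open GraphDiagram consecutive
    from<to : ∀ a → from a < to a
    from<to zero       = s≤s z≤n
    from<to (suc zero) = s≤s (s≤s z≤n)
    span : Spans
    span f p {zero}           {suc zero}       _ = p zero
    span f p {zero}           {suc (suc zero)} _ = <-trans {i = f zero} (p zero) (p (suc zero))
    span f p {suc zero}       {suc zero}       (s≤s ())
    span f p {suc zero}       {suc (suc zero)} _ = p (suc zero)
    span f p {suc (suc zero)} {suc zero}       (s≤s ())
    span f p {suc (suc zero)} {suc (suc zero)} (s≤s (s≤s ()))
    open Spanning from<to span
    L : Legs F X
    L (inj₁ zero)             = x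
    L (inj₁ (suc zero))       = y
    L (inj₁ (suc (suc _)))    = z
    L (inj₂ zero)             = h
    L (inj₂ (suc _))          = k
    L-commutes : Commutes F L
    L-commutes (inj₁ zero)    = h₀
    L-commutes (inj₁ (suc zero)) = k₀
    L-commutes (inj₂ zero)    = h₁
    L-commutes (inj₂ (suc zero)) = k₁
    mediating = preserveUniversal (idF 𝓛) F pres legs legs-commute legs-universal L L-commutes
    u = proj₁ mediating
    fac = proj₁ (proj₂ mediating)
    long : IncMap 2 3
    long = segment {a = zero} {b = suc (suc zero)} (s≤s z≤n)

  points : Obj → Target ℓ e (ℓ ⊔ e)
  points X = record
    { Carrier = Point X ; _≈_ = _≈_ ; equiv = ≈-equiv ; _≺_ = Link
    ; ≺-resp = link-resp ; ≺-trans = link-trans }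

  -- `X` represents the relation-respecting families of points indexed by `R`: morphisms out of `X`
  -- correspond to such families through their values on `u`.
  record UniversalFamily (R : TransRel) {X : Obj} (u : Fin (size R) → Point X) : Set (o ⊔ ℓ ⊔ e) where
    field
      links  : Respects (points X) R u
      extend : ∀ {Y} (x : Fin (size R) → Point Y) → Respects (points Y) R x →
               Σ (X ⇒ Y) λ v → ∀ a → v ● u a ≈ x a
      unique : ∀ {Y} (v w : X ⇒ Y) → (∀ a → v ● u a ≈ w ● u a) → v ≈ w

  open UniversalFamily

  module _ (R : TransRel) where
    open RelGraph R
    open GraphDiagram graph

    edge-link : ∀ {X} {u : Fin (size R) → Point X} → Respects (points X) R u →
                ∀ a → Link (u (proj₁ (related a))) (u (proj₁ (proj₂ (related a))))
    edge-link f a = f (proj₂ (proj₂ (related a)))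

    familyLegs : ∀ {X} (u : Fin (size R) → Point X) → Respects (points X) R u → Legs F X
    familyLegs u f (inj₁ a) = u a
    familyLegs u f (inj₂ a) = proj₁ (edge-link f a)

    familyLegs-commute : ∀ {X} (u : Fin (size R) → Point X) (f : Respects (points X) R u) →
                         Commutes F (familyLegs u f)
    familyLegs-commute u f (inj₁ a) = proj₁ (proj₂ (edge-link f a))
    familyLegs-commute u f (inj₂ a) = proj₂ (proj₂ (edge-link f a))

    -- Segments are determined by their endpoints, so only vertices matter.
    agree-on-vertices : ∀ {X Y} (L : Legs F X) → Commutes F L → (L' : Legs F Y) → Commutes F L' →
                        (v : X ⇒ Y) → (∀ a → v ● L (inj₁ a) ≈ L' (inj₁ a)) → ∀ n → v ● L n ≈ L' n
    agree-on-vertices L comm L' comm' v p (inj₁ a) = p a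
    agree-on-vertices L comm L' comm' v p (inj₂ a) = link-unique
      (v ● L (inj₂ a) , ≈-trans (pullʳ (comm (inj₁ a))) (p _) , ≈-trans (pullʳ (comm (inj₂ a))) (p _))
      (L' (inj₂ a) , comm' (inj₁ a) , comm' (inj₂ a))

    universalLegs⇒family : ∀ {X} (L : Legs F X) → Commutes F L → Universal F L →
                           UniversalFamily R (λ a → L (inj₁ a))
    universalLegs⇒family L comm univ .links {x} {y} r =
      subst (λ (a , b , _) → Link (L (inj₁ a)) (L (inj₁ b))) (related-edgeOf (x , y , r))
        (L (inj₂ pair) , comm (inj₁ pair) , comm (inj₂ pair))
      where
      pair : Fin card
      pair = edgeOf (x , y , r)
    universalLegs⇒family L comm univ .extend x f =
      let u , fac , _ = univ (familyLegs x f) (familyLegs-commute x f)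
      in u , λ a → fac (inj₁ a)
    universalLegs⇒family L comm univ .unique v w p =
      -- Both `v` and `w` mediate the cocone obtained by composing the legs with `w`.
      let L' = λ n → w ● L n
          comm' = λ z → pullʳ (comm z)
          _ , _ , uniq = univ L' comm'
      in ≈-trans (uniq v (agree-on-vertices L comm L' comm' v p))
                 (≈-sym (uniq w λ _ → ≈-refl))

    -- This converse turns a universal family back into a colimit, which a cocontinuous functor can
    -- then carry along.
    family⇒universalLegs : ∀ {X} (u : Fin (size R) → Point X) (U : UniversalFamily R u) →
                           Universal F (familyLegs u (links U))
    family⇒universalLegs u U L' comm' with extend U (λ a → L' (inj₁ a)) (λ {x} {y} r →
        subst (λ (a , b , _) → Link (L' (inj₁ a)) (L' (inj₁ b))) (related-edgeOf (x , y , r))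
          (L' (inj₂ (edgeOf (x , y , r))) , comm' (inj₁ _) , comm' (inj₂ _)))
    ... | v , fac = v
        , agree-on-vertices (familyLegs u (links U)) (familyLegs-commute u (links U)) L' comm' v fac
        , λ w p → unique U w v λ a → ≈-trans (p (inj₁ a)) (≈-sym (fac a))

  -- H extends F along Z: each H X is freely generated by points indexed by
  -- the elements of Z X and links indexed by its related pairs.
  record Extension {oA ℓA eA} {A : Category oA ℓA eA} (Z : Functor A 𝓣) (H : Functor A E) :
         Set (oA ⊔ ℓA ⊔ o ⊔ ℓ ⊔ e) where
    field
      pt      : ∀ X → Fin (size (F₀ Z X)) → Point (F₀ H X)
      univ    : ∀ X → UniversalFamily (F₀ Z X) (pt X)
      pt-nat  : ∀ {X Y} (f : Category._⇒_ A X Y) a → F₁ H f ● pt X a ≈ pt Y (map (F₁ Z f) a)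

  open Extension

  module _ {oA ℓA eA} {A : Category oA ℓA eA} {Z : Functor A 𝓣} where

    comparison : ∀ {H H' : Functor A E} (S : Extension Z H) (S' : Extension Z H') X →
                 Σ (F₀ H X ⇒ F₀ H' X) λ v → ∀ a → v ● pt S X a ≈ pt S' X a
    comparison S S' X = extend (univ S X) (pt S' X) (links (univ S' X))

    comparison-inverse : ∀ {H H' : Functor A E} (S : Extension Z H) (S' : Extension Z H') X →
                         proj₁ (comparison S' S X) ● proj₁ (comparison S S' X) ≈ id
    comparison-inverse S S' X = unique (univ S X) _ _ λ a →
      ≈-trans (pullʳ (proj₂ (comparison S S' X) a))
        (≈-trans (proj₂ (comparison S' S X) a) (≈-sym identityˡ))

    -- Both values are freely generated by the same points and links. Matching the points gives
    -- inverse comparisons, and naturality is tested on points.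
    extension-unique : ∀ {H H' : Functor A E} → Extension Z H → Extension Z H' → NatIso H H'
    extension-unique {H} {H'} S S' = record
      { η = λ X → proj₁ (comparison S S' X) ; η⁻¹ = λ X → proj₁ (comparison S' S X)
      ; isoˡ = comparison-inverse S S' ; isoʳ = comparison-inverse S' S
      ; natural = λ {X} {Y} f → unique (univ S X) _ _ λ a →
          (proj₁ (comparison S S' Y) ● F₁ H f) ● pt S X a ≈⟨ pullʳ (pt-nat S f a) ⟩
          proj₁ (comparison S S' Y) ● pt S Y (map (F₁ Z f) a) ≈⟨ proj₂ (comparison S S' Y) _ ⟩
          pt S' Y (map (F₁ Z f) a)                        ≈⟨ pt-nat S' f a ⟨
          F₁ H' f ● pt S' X a                             ≈⟨ _ ●⟨ proj₂ (comparison S S' X) a ⟨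
          F₁ H' f ● (proj₁ (comparison S S' X) ● pt S X a) ≈⟨ assoc ⟨
          (F₁ H' f ● proj₁ (comparison S S' X)) ● pt S X a ∎ }

  restrict : ∀ {oA ℓA eA} {A : Category oA ℓA eA} {H : Functor 𝓣 E} (Z : Functor A 𝓣) →
             Extension (idF 𝓣) H → Extension Z (H ∘F Z)
  restrict Z S = record
    { pt = λ X → pt S (F₀ Z X) ; univ = λ X → univ S (F₀ Z X) ; pt-nat = λ f → pt-nat S (F₁ Z f) }

  -- In `𝓛` a chain is the colimit of its vertices and all its segments, and `F` preserves this
  -- colimit.
  canonical : Extension y₀ F
  canonical = record
    { pt = λ m a → F₁ F (vertex a) ; univ = family
    ; pt-nat = λ f a → ≈-trans (≈-sym (F-∘ F)) (F-resp-≈ F λ _ → refl) }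
    where
    family : ∀ m → UniversalFamily (chain m) (λ a → F₁ F (vertex a))
    family m = universalLegs⇒family (chain m) (λ v → F₁ F (legs v))
        (λ z → ≈-trans (≈-sym (F-∘ F)) (F-resp-≈ F (legs-commute z)))
        (preserveUniversal (idF 𝓛) F pres legs legs-commute legs-universal)
      where
      open RelGraph (chain m)
      open GraphDiagram graph
      span : Spans
      span f p {i} {j} i<j =
        subst (λ (a , b , _) → f a < f b) (related-edgeOf (i , j , fromWitness i<j)) (p _)
      src<tgt : ∀ a → proj₁ (related a) < proj₁ (proj₂ (related a))
      src<tgt a = toWitness (proj₂ (proj₂ (related a)))
      open Spanning src<tgt span

  module Existence (cocomplete : FinitelyCocomplete E) where

    private
      module _ (R : TransRel) where
        open GraphDiagram (RelGraph.graph R)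

        generated : Σ Obj λ X → Σ (Legs F X) λ L → Commutes F L × Universal F L
        generated = colimitOf cocomplete F

        carrier : Obj
        carrier = proj₁ generated

        point : Fin (size R) → Point carrier
        point a = proj₁ (proj₂ generated) (inj₁ a)

        abstract
          family : UniversalFamily R point
          family = universalLegs⇒family R (proj₁ (proj₂ generated))
                     (proj₁ (proj₂ (proj₂ generated))) (proj₂ (proj₂ (proj₂ generated)))

      induced : ∀ {R R'} (f : RelHom R R') →
                Σ (carrier R ⇒ carrier R') λ v → ∀ a → v ● point R a ≈ point R' (map f a)
      induced {R} {R'} f =
        extend (family R) (λ a → point R' (map f a)) λ r → links (family R') (resp f r)

    -- The functor laws are tested on the generating points, on which an induced morphism acts
    -- through the indices.
    extension : Functor 𝓣 E
    extension = record
      { F₀ = carrier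
      ; F₁ = λ f → proj₁ (induced f)
      ; F-resp-≈ = λ {R} {R'} {f} {g} p → unique (family R) _ _ λ a →
          ≈-trans (proj₂ (induced f) a)
            (≈-trans (≈-reflexive (cong (point R') (p a))) (≈-sym (proj₂ (induced g) a)))
      ; F-id = λ {R} → unique (family R) _ _ λ a →
          ≈-trans (proj₂ (induced (Category.id 𝓣 {R})) a) (≈-sym identityˡ)
      ; F-∘ = λ {R} {R'} {R''} {f} {g} → unique (family R) _ _ λ a →
          ≈-trans (proj₂ (induced (Category._∘_ 𝓣 g f)) a)
            (≈-sym (≈-trans (pullʳ (proj₂ (induced f) a)) (proj₂ (induced g) (map f a)))) }

    isExtension : Extension (idF 𝓣) extension
    isExtension = record { pt = point ; univ = family ; pt-nat = λ f → proj₂ (induced f) }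

  -- Morphisms out of `H X` are relation-respecting families of points, so a cocone under the image
  -- of `D` is a cocone under `D` with values in the points of its apex. The colimit construction in
  -- `𝓣` extends it to a family `g` on classes.
  extension-preserves : {H : Functor 𝓣 E} → Extension (idF 𝓣) H → PreservesFinColimits H
  extension-preserves {H} S Γ D c univC c' = u
      , (λ i → unique (univ S (obj D i)) _ _ λ a →
          (u ● F₁ H (leg c i)) ● pt S (obj D i) a   ≈⟨ pullʳ (pt-nat S (leg c i) a) ⟩
          u ● pt S (apex c) (map (leg c i) a)       ≈⟨ u-fac (map (leg c i) a) ⟩
          g (map κ (map (leg c i) a))               ≈⟨ ≈-reflexive (cong g (κ-leg i a)) ⟩
          g (cls (i , a))                           ≈⟨ mediate-cls (points (apex c')) family (i , a) ⟩
          leg c' i ● pt S (obj D i) a               ∎)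
      , λ w p → unique (univ S (apex c)) w u λ a →
          w ● pt S (apex c) a                       ≈⟨ w ●⟨ ≈-reflexive (cong (pt S (apex c)) (ρκ a)) ⟨
          w ● pt S (apex c) (map ρ (map κ a))       ≈⟨ w-determined w p (map κ a) ⟩
          g (map κ a)                               ≈⟨ u-fac a ⟨
          u ● pt S (apex c) a                       ∎
    where
    open Shape
    open Colimit𝓣 D
    family : CoconeTo (points (apex c')) D
    family = record
      { leg = λ i a → leg c' i ● pt S (obj D i) a
      ; respects = λ i r → link-map (leg c' i) (links (univ S (obj D i)) r)
      ; commutes = λ k x →
          leg c' (t Γ k) ● pt S (obj D (t Γ k)) (map (arr D k) x)     ≈⟨ _ ●⟨ pt-nat S (arr D k) x ⟨
          leg c' (t Γ k) ● (F₁ H (arr D k) ● pt S (obj D (s Γ k)) x)  ≈⟨ pullˡ (commute c' k) ⟩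
          leg c' (s Γ k) ● pt S (obj D (s Γ k)) x                     ∎ }

    g : Fin card → Point (apex c')
    g = mediate (points (apex c')) family

    -- The given colimit `c` is compared with the constructed one, so that `g` can be read on its
    -- apex.
    κ : RelHom (apex c) colimit
    κ = proj₁ (univC cocone)

    κ-leg : ∀ i x → map κ (map (leg c i) x) ≡ cls (i , x)
    κ-leg = proj₁ (proj₂ (univC cocone))

    ρ : RelHom colimit (apex c)
    ρ = proj₁ (isColimit c)

    ρ-cls : ∀ i x → map ρ (cls (i , x)) ≡ map (leg c i) x
    ρ-cls = proj₁ (proj₂ (isColimit c))

    ρκ : ∀ a → map ρ (map κ a) ≡ a
    ρκ a = P.trans (uniq (Category._∘_ 𝓣 ρ κ) (λ i x → P.trans (cong (map ρ) (κ-leg i x)) (ρ-cls i x)) a)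
                   (P.sym (uniq (Category.id 𝓣) (λ _ _ → refl) a))
      where
      uniq = proj₂ (proj₂ (univC c))

    mediated : Σ (F₀ H (apex c) ⇒ apex c') λ u → ∀ a → u ● pt S (apex c) a ≈ g (map κ a)
    mediated = extend (univ S (apex c)) (λ a → g (map κ a))
      λ r → mediate-respects (points (apex c')) family (resp κ r)

    u : F₀ H (apex c) ⇒ apex c'
    u = proj₁ mediated

    u-fac : ∀ a → u ● pt S (apex c) a ≈ g (map κ a)
    u-fac = proj₂ mediated

    -- Every class comes from an element of some object of the diagram, and there the leg fixes the
    -- value of `w`.
    w-determined : ∀ w → (∀ i → w ● F₁ H (leg c i) ≈ leg c' i) →
                   ∀ z → w ● pt S (apex c) (map ρ z) ≈ g z
    w-determined w p = agree (points (apex c')) (λ z → w ● pt S (apex c) (map ρ z)) g λ (i , x) →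
      w ● pt S (apex c) (map ρ (cls (i , x)))       ≈⟨ w ●⟨ ≈-reflexive (cong (pt S (apex c)) (ρ-cls i x)) ⟩
      w ● pt S (apex c) (map (leg c i) x)           ≈⟨ w ●⟨ pt-nat S (leg c i) x ⟨
      w ● (F₁ H (leg c i) ● pt S (obj D i) x)       ≈⟨ pullˡ (p i) ⟩
      leg c' i ● pt S (obj D i) x                   ≈⟨ mediate-cls (points (apex c')) family (i , x) ⟨
      g (cls (i , x))                               ∎

module _ {o ℓ e o' ℓ' e'} {E : Category o ℓ e} {E' : Category o' ℓ' e'}
         (F : Functor 𝓛 E) (presF : PreservesFinColimits F)
         (F' : Functor 𝓛 E') (presF' : PreservesFinColimits F')
         (K : Functor E E') (presK : PreservesFinColimits K) (γ : NatIso (K ∘F F) F') where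
  private
    module PF  = Points F presF
    module PF' = Points F' presF'
  open Hom E'

  -- `K` preserves the colimit of vertices and segments that presents `H X`, and the inverse of `γ`
  -- turns it into a colimit for `F'`.
  extension-image : {H : Functor 𝓣 E} → PF.Extension (idF 𝓣) H → PF'.Extension (idF 𝓣) (K ∘F H)
  extension-image {H} S = record
    -- The image of a point starts at `K (F 1)`; precomposition with `η⁻¹ γ 1` makes it start at
    -- `F' 1`.
    { pt = λ X a → F₁ K (pt X a) ● η⁻¹ γ 1
    ; univ = family
    ; pt-nat = λ {X} {Y} f a → pullˡ (≈-trans (≈-sym (F-∘ K)) (F-resp-≈ K (pt-nat f a))) }
    where
    open PF.Extension S
    family : ∀ X → PF'.UniversalFamily X (λ a → F₁ K (pt X a) ● η⁻¹ γ 1)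
    family X = PF'.universalLegs⇒family X (λ v → F₁ K (L v) ● η⁻¹ γ (ob v))
        (λ z →
          (F₁ K (L (cod z)) ● η⁻¹ γ (ob (cod z))) ● F₁ F' (ar z)
            ≈⟨ pullʳ (η⁻¹-natural (ar z)) ⟩
          F₁ K (L (cod z)) ● (F₁ K (F₁ F (ar z)) ● η⁻¹ γ (ob (dom z)))
            ≈⟨ pullˡ (≈-trans (≈-sym (F-∘ K)) (F-resp-≈ K (L-commutes z))) ⟩
          F₁ K (L (dom z)) ● η⁻¹ γ (ob (dom z)) ∎)
        (transportUniversal γ (λ v → F₁ K (L v))
          (preserveUniversal F K presK L L-commutes (PF.family⇒universalLegs X (pt X) (univ X))))
      where
      open GraphDiagram (RelGraph.graph X)
      L : Legs F (F₀ H X)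
      L = PF.familyLegs X (pt X) (PF.UniversalFamily.links (univ X))
      L-commutes : Commutes F L
      L-commutes = PF.familyLegs-commute X (pt X) (PF.UniversalFamily.links (univ X))
      η⁻¹-natural : ∀ {m n} (f : IncMap m n) → η⁻¹ γ n ● F₁ F' f ≈ F₁ K (F₁ F f) ● η⁻¹ γ m
      η⁻¹-natural {m} {n} f =
        η⁻¹ γ n ● F₁ F' f                                 ≈⟨ _ ●⟨ cancelʳ (isoʳ γ m) ⟨
        η⁻¹ γ n ● ((F₁ F' f ● η γ m) ● η⁻¹ γ m)           ≈⟨ _ ●⟨ (natural γ f ⟩● _) ⟨
        η⁻¹ γ n ● ((η γ n ● F₁ K (F₁ F f)) ● η⁻¹ γ m)     ≈⟨ _ ●⟨ assoc ⟩
        η⁻¹ γ n ● (η γ n ● (F₁ K (F₁ F f) ● η⁻¹ γ m))     ≈⟨ pullˡ (isoˡ γ n) ⟩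
        id ● (F₁ K (F₁ F f) ● η⁻¹ γ m)                    ≈⟨ identityˡ ⟩
        F₁ K (F₁ F f) ● η⁻¹ γ m                           ∎

-- Composition of natural isomorphisms and equivalences

module _ {o ℓ e o' ℓ' e'} {C : Category o ℓ e} {D : Category o' ℓ' e'} where
  open Hom D

  infixr 9 _∘ᴺ_

  _∘ᴺ_ : {F G H : Functor C D} → NatIso G H → NatIso F G → NatIso F H
  _∘ᴺ_ {F} {G} {H} β α = record
    { η = λ A → η β A ● η α A ; η⁻¹ = λ A → η⁻¹ α A ● η⁻¹ β A
    ; isoˡ = λ A → ≈-trans (pullʳ (≈-trans (pullˡ (isoˡ β A)) identityˡ)) (isoˡ α A)
    ; isoʳ = λ A → ≈-trans (pullʳ (≈-trans (pullˡ (isoʳ α A)) identityˡ)) (isoʳ β A)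
    ; natural = λ {A} {B} f →
        (η β B ● η α B) ● F₁ F f   ≈⟨ pullʳ (natural α f) ⟩
        η β B ● (F₁ G f ● η α A)   ≈⟨ pullˡ (natural β f) ⟩
        (F₁ H f ● η β A) ● η α A   ≈⟨ assoc ⟩
        F₁ H f ● (η β A ● η α A)   ∎ }

module _ {o₁ ℓ₁ e₁ o₂ ℓ₂ e₂ o₃ ℓ₃ e₃ o₄ ℓ₄ e₄}
         {A : Category o₁ ℓ₁ e₁} {B : Category o₂ ℓ₂ e₂}
         {C : Category o₃ ℓ₃ e₃} {D : Category o₄ ℓ₄ e₄} where
  open Hom D

  -- Composition of functors is associative only up to the proof fields, so
  -- the whiskered isomorphism is stated with both bracketings at its ends.
  whisker : {L : Functor A B} {M : Functor B C} {N : Functor A C} →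
            (G : Functor C D) → NatIso (M ∘F L) N → NatIso ((G ∘F M) ∘F L) (G ∘F N)
  whisker {L} {M} {N} G α = record
    { η = λ X → F₁ G (η α X) ; η⁻¹ = λ X → F₁ G (η⁻¹ α X)
    ; isoˡ = λ X → image (isoˡ α X) ; isoʳ = λ X → image (isoʳ α X)
    ; natural = λ f → ≈-trans (≈-sym (F-∘ G)) (≈-trans (F-resp-≈ G (natural α f)) (F-∘ G)) }
    where
    image : ∀ {X Y} {f : Category._⇒_ C X Y} {g : Category._⇒_ C Y X} →
            Category._≈_ C (Category._∘_ C g f) (Category.id C) → F₁ G g ● F₁ G f ≈ id
    image p = ≈-trans (≈-sym (F-∘ G)) (≈-trans (F-resp-≈ G p) (F-id G))

module _ {o₁ ℓ₁ e₁ o₂ ℓ₂ e₂ o₃ ℓ₃ e₃}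
         {A : Category o₁ ℓ₁ e₁} {B : Category o₂ ℓ₂ e₂} {C : Category o₃ ℓ₃ e₃} where

  -- The inner pair cancels by `α`, the outer one by `β`. This serves for the unit of a composite
  -- equivalence and, with the roles exchanged, for its counit.
  conjugate : (F : Functor A B) (G : Functor B A) (H : Functor B C) (K : Functor C B) →
              NatIso (K ∘F H) (idF B) → NatIso (G ∘F F) (idF A) →
              NatIso ((G ∘F K) ∘F (H ∘F F)) (idF A)
  conjugate F G H K α β = record
    { η = λ X → η β X ● F₁ G (η α (F₀ F X))
    ; η⁻¹ = λ X → F₁ G (η⁻¹ α (F₀ F X)) ● η⁻¹ β X
    ; isoˡ = λ X → ≈-trans (pullʳ (≈-trans (pullˡ (isoˡ β X)) identityˡ)) (image (isoˡ α (F₀ F X)))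
    ; isoʳ = λ X → ≈-trans (pullʳ (≈-trans (pullˡ (image (isoʳ α (F₀ F X)))) identityˡ)) (isoʳ β X)
    ; natural = λ {X} {Y} f →
        (η β Y ● F₁ G (η α (F₀ F Y))) ● F₁ G (F₁ K (F₁ H (F₁ F f)))
          ≈⟨ pullʳ (≈-trans (≈-sym (F-∘ G)) (≈-trans (F-resp-≈ G (natural α (F₁ F f))) (F-∘ G))) ⟩
        η β Y ● (F₁ G (F₁ F f) ● F₁ G (η α (F₀ F X)))   ≈⟨ pullˡ (natural β f) ⟩
        (f ● η β X) ● F₁ G (η α (F₀ F X))               ≈⟨ assoc ⟩
        f ● (η β X ● F₁ G (η α (F₀ F X)))               ∎ }
    where
    open Hom A
    image : ∀ {X Y} {f : Category._⇒_ B X Y} {g : Category._⇒_ B Y X} →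
            Category._≈_ B (Category._∘_ B g f) (Category.id B) → F₁ G g ● F₁ G f ≈ id
    image p = ≈-trans (≈-sym (F-∘ G)) (≈-trans (F-resp-≈ G p) (F-id G))

equivalence-trans : ∀ {o₁ ℓ₁ e₁ o₂ ℓ₂ e₂ o₃ ℓ₃ e₃}
  {A : Category o₁ ℓ₁ e₁} {B : Category o₂ ℓ₂ e₂} {C : Category o₃ ℓ₃ e₃} →
  Equivalence A B → Equivalence B C → Equivalence A C
equivalence-trans S S' = record
  { F = S'.F ∘F S.F ; G = S.G ∘F S'.G
  ; unit = conjugate S.F S.G S'.F S'.G S'.unit S.unit
  ; counit = conjugate S'.G S'.F S.G S.F S.counit S'.counit }
  where
  module S  = Equivalence S
  module S' = Equivalence S'

open FinGraph
open GraphHom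

-- Graphs and transitive relations

-- A single edge is a path of length one, so the path condition already forbids parallel edges.
edge-unique : ∀ {G} → PathCondition G → ∀ {a b} → src G a ≡ src G b → tgt G a ≡ tgt G b → a ≡ b
edge-unique pc {a} {b} p q with pc _ _ (edge b)
... | _ , _ , uniq = P.trans (uniq a p q) (P.sym (uniq b refl refl))

-- Without parallel edges in the codomain, the vertex map determines the edge map; equations in `𝓖`
-- thus reduce to vertices.
graphHom-≈ : ∀ {G H} → PathCondition H → (f g : GraphHom G H) →
             (∀ v → fV f v ≡ fV g v) → ∀ a → fE f a ≡ fE g a
graphHom-≈ pc f g p a = edge-unique pc
  (P.trans (src-comm f a) (P.trans (p _) (P.sym (src-comm g a))))
  (P.trans (tgt-comm f a) (P.trans (p _) (P.sym (tgt-comm g a))))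

module _ (X : TransRel) where
  open RelGraph X

  path⇒rel : ∀ {x y} → Path graph x y → T (rel X x y)
  path⇒rel (edge a) = proj₂ (proj₂ (related a))
  path⇒rel (a ∷ p)  = trans X (proj₂ (proj₂ (related a))) (path⇒rel p)

  relGraph-pathCondition : PathCondition graph
  relGraph-pathCondition x y p = edgeOf r
    , (cong proj₁ (related-edgeOf r) , cong (λ r → proj₁ (proj₂ r)) (related-edgeOf r))
    -- Edges with equal endpoints could differ only in the proof that these are related, and such
    -- proofs are equal.
    , λ { b refl refl → P.trans (P.sym (edgeOf-related b))
            (cong (λ t → edgeOf (_ , _ , t)) (T-irrelevant _ _)) }
    where
    r : Related
    r = x , y , path⇒rel p

relGraph-map : ∀ {X Y} → RelHom X Y → GraphHom (RelGraph.graph X) (RelGraph.graph Y)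
relGraph-map {X} {Y} f = record
  { fV = map f ; fE = λ a → Y.edgeOf (image a)
  ; src-comm = λ a → cong proj₁ (Y.related-edgeOf (image a))
  ; tgt-comm = λ a → cong (λ r → proj₁ (proj₂ r)) (Y.related-edgeOf (image a)) }
  where
  module X = RelGraph X
  module Y = RelGraph Y
  image : Fin X.card → Y.Related
  image a = let x , y , r = X.related a in map f x , map f y , resp f r

toGraph : Functor 𝓣 𝓖
toGraph = record
  { F₀ = F₀'
  ; F₁ = relGraph-map
  ; F-resp-≈ = λ {X} {Y} {f} {g} p → p
      , graphHom-≈ (relGraph-pathCondition Y) (relGraph-map f) (relGraph-map g) p
  ; F-id = λ {X} → (λ _ → refl)
      , graphHom-≈ (relGraph-pathCondition X) (relGraph-map (Category.id 𝓣 {X}))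
          (Category.id 𝓖 {F₀' X}) (λ _ → refl)
  ; F-∘ = λ {X} {Y} {Z} {f} {g} → (λ _ → refl)
      , graphHom-≈ (relGraph-pathCondition Z) (relGraph-map (Category._∘_ 𝓣 g f))
          (Category._∘_ 𝓖 {F₀' X} {F₀' Y} {F₀' Z} (relGraph-map g) (relGraph-map f)) (λ _ → refl) }
  where
  F₀' : TransRel → Σ FinGraph PathCondition
  F₀' X = RelGraph.graph X , relGraph-pathCondition X

Adjacent : (G : FinGraph) → Fin (nV G) → Fin (nV G) → Set
Adjacent G x y = Σ (Fin (nE G)) λ a → src G a ≡ x × tgt G a ≡ y

abstract
  adjacent : ∀ G → Fin (nV G) → Fin (nV G) → Bool
  adjacent G x y = ⌊ any? (λ a → (src G a ≟ x) ×-dec (tgt G a ≟ y)) ⌋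

  ⇒adjacent : ∀ G {x y} → Adjacent G x y → T (adjacent G x y)
  ⇒adjacent G = fromWitness

  adjacent⇒ : ∀ G {x y} → T (adjacent G x y) → Adjacent G x y
  adjacent⇒ G = toWitness

adjacency : Σ FinGraph PathCondition → TransRel
adjacency (G , pc) = record
  { size = nV G ; rel = adjacent G
  ; trans = λ p q → ⇒adjacent G (compose (adjacent⇒ G p) (adjacent⇒ G q)) }
  where
  compose : ∀ {x y z} → Adjacent G x y → Adjacent G y z → Adjacent G x z
  compose (a , refl , refl) (b , p , refl) =
    -- The path condition contracts the path of length two to an edge.
    let c , e , _ = pc _ _ (a ∷ subst (λ v → Path G v (tgt G b)) p (edge b)) in c , e

fromGraph : Functor 𝓖 𝓣
fromGraph = record
  { F₀ = adjacency
  ; F₁ = λ {G} {H} f → record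
      { map = fV f
      ; resp = λ r → let a , p , q = adjacent⇒ (proj₁ G) r in ⇒adjacent (proj₁ H)
          (fE f a , P.trans (src-comm f a) (cong (fV f) p) , P.trans (tgt-comm f a) (cong (fV f) q)) }
  ; F-resp-≈ = proj₁ ; F-id = λ _ → refl ; F-∘ = λ _ → refl }

-- Both composites keep the vertices, so every component is the identity on them and `graphHom-≈`
-- settles the equations on edges.
𝓣≃𝓖 : Equivalence 𝓣 𝓖
𝓣≃𝓖 = record
  { F = toGraph ; G = fromGraph
  ; unit = record
      { η = λ X → record { map = λ x → x ; resp = from X }
      ; η⁻¹ = λ X → record { map = λ x → x ; resp = into X }
      ; isoˡ = λ _ _ → refl ; isoʳ = λ _ _ → refl ; natural = λ _ _ → refl }
  ; counit = record
      { η = out ; η⁻¹ = back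
      ; isoˡ = λ G → (λ _ → refl) , graphHom-≈ (relGraph-pathCondition (adjacency G))
          (Category._∘_ 𝓖 {A G} {G} {A G} (back G) (out G)) (Category.id 𝓖 {A G}) (λ _ → refl)
      ; isoʳ = λ G → (λ _ → refl) , graphHom-≈ (proj₂ G)
          (Category._∘_ 𝓖 {G} {A G} {G} (out G) (back G)) (Category.id 𝓖 {G}) (λ _ → refl)
      ; natural = λ {G} {H} f → (λ _ → refl) , graphHom-≈ (proj₂ H)
          (Category._∘_ 𝓖 {A G} {A H} {H} (out H) (relGraph-map (F₁ fromGraph {G} {H} f)))
          (Category._∘_ 𝓖 {A G} {G} {H} f (out G)) (λ _ → refl) } }
  where
  A : Σ FinGraph PathCondition → Σ FinGraph PathCondition
  A G = F₀ toGraph (adjacency G)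

  from : ∀ X {x y} → T (rel (adjacency (F₀ toGraph X)) x y) → T (rel X x y)
  from X r =
    let a , p , q = adjacent⇒ (RelGraph.graph X) r
    in subst₂ (λ x y → T (rel X x y)) p q (proj₂ (proj₂ (RelGraph.related X a)))

  into : ∀ X {x y} → T (rel X x y) → T (rel (adjacency (F₀ toGraph X)) x y)
  into X {x} {y} r = ⇒adjacent (RelGraph.graph X)
    ( edgeOf (x , y , r) , cong proj₁ (related-edgeOf _)
    , cong (λ r → proj₁ (proj₂ r)) (related-edgeOf _) )
    where open RelGraph X

  out : ∀ G → GraphHom (proj₁ (A G)) (proj₁ G)
  out G = record
    { fV = λ v → v ; fE = λ a → proj₁ (adj a)
    ; src-comm = λ a → proj₁ (proj₂ (adj a)) ; tgt-comm = λ a → proj₂ (proj₂ (adj a)) }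
    where
    open RelGraph (adjacency G)
    adj : ∀ a → Adjacent (proj₁ G) (src graph a) (tgt graph a)
    adj a = adjacent⇒ (proj₁ G) (proj₂ (proj₂ (related a)))

  back : ∀ G → GraphHom (proj₁ G) (proj₁ (A G))
  back G = record
    { fV = λ v → v ; fE = λ a → edgeOf (pair a)
    ; src-comm = λ a → cong proj₁ (related-edgeOf (pair a))
    ; tgt-comm = λ a → cong (λ r → proj₁ (proj₂ r)) (related-edgeOf (pair a)) }
    where
    open RelGraph (adjacency G)
    pair : Fin (nE (proj₁ G)) → Related
    pair a = src (proj₁ G) a , tgt (proj₁ G) a , ⇒adjacent (proj₁ G) (a , refl , refl)

-- Comparison with the free completion

∘-preserves : ∀ {o₁ ℓ₁ e₁ o₂ ℓ₂ e₂ o₃ ℓ₃ e₃}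
  {A : Category o₁ ℓ₁ e₁} {B : Category o₂ ℓ₂ e₂} {C : Category o₃ ℓ₃ e₃}
  {F : Functor A B} {G : Functor B C} →
  PreservesFinColimits F → PreservesFinColimits G → PreservesFinColimits (G ∘F F)
∘-preserves {F = F} p q Γ D c univ = q Γ (mapDiagram F D) (mapCocone F c) (p Γ D c univ)

idF-preserves : ∀ {o ℓ e} {C : Category o ℓ e} → PreservesFinColimits (idF C)
idF-preserves Γ D c univ = univ

module _ {oP ℓP eP} (Pc : Category oP ℓP eP) (y : Functor 𝓛 Pc)
         (free : IsFreeConsFinCocompletion 𝓛 Pc y) where
  open IsFreeConsFinCocompletion free
  private
    module EP = Points y preserves
    module ET = Points y₀ y₀-preserves

  -- `K` comes from the universal property of `Pc` applied to `𝓣`, and `G` is the extension of `y`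
  -- along `y₀`. The unit follows from uniqueness for `Pc`, as `G ∘F K` and the identity both
  -- restrict to `y`; the counit holds because `K ∘F G` and the identity both extend `y₀`.
  Pc≃𝓣 : Equivalence Pc 𝓣
  Pc≃𝓣 with universal 0ℓ 0ℓ 0ℓ 𝓣 𝓣-cocomplete y₀ y₀-preserves
  ... | (K , K-preserves , κ) , _ = record
    { F = K ; G = G
    ; unit = proj₁ (proj₂ (universal oP ℓP eP Pc cocomplete y preserves) (G ∘F K) (idF Pc)
               (∘-preserves {F = K} {G} K-preserves G-preserves) idF-preserves
               GKy≅y idFy≅y)
    ; counit = ET.extension-unique
        (extension-image y preserves y₀ y₀-preserves K K-preserves κ isExtension) identityExtension }
    where
    open EP.Existence cocomplete renaming (extension to G)

    G-preserves : PreservesFinColimits G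
    G-preserves = EP.extension-preserves isExtension

    GKy≅y : NatIso ((G ∘F K) ∘F y) y
    -- `κ` replaces `K ∘F y` by `y₀`; on chains, `G` and `y` are both extensions along `y₀`.
    GKy≅y = EP.extension-unique (EP.restrict y₀ isExtension) EP.canonical ∘ᴺ whisker {L = y} {K} {y₀} G κ

    idFy≅y : NatIso (idF Pc ∘F y) y
    idFy≅y = record
      { η = λ _ → id ; η⁻¹ = λ _ → id ; isoˡ = λ _ → identityˡ ; isoʳ = λ _ → identityˡ
      ; natural = λ _ → ≈-trans identityˡ (≈-sym identityʳ) }
      where open Hom Pc

    -- In `𝓣` a point of `X` is an element and a link is a related pair, so each object is freely
    -- generated by its own elements.
    identityExtension : ET.Extension (idF 𝓣) (idF 𝓣)
    identityExtension = record
      { pt = λ X a → record { map = λ _ → a ; resp = λ { {zero} {zero} () } }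
      ; univ = λ X → record
          { links = λ {a} {b} r → edgeMap X r , (λ { zero → refl }) , (λ { zero → refl })
          ; extend = λ x f →
              record { map = λ a → map (x a) zero ; resp = λ r → link⇒rel (x _) (x _) (f r) }
              , λ { a zero → refl }
          ; unique = λ v w p a → p a zero }
      ; pt-nat = λ _ _ _ → refl }
      where
      edgeMap : ∀ X {a b} → T (rel X a b) → RelHom (chain 2) X
      edgeMap X {a} {b} r = record { map = ends ; resp = λ {i} {j} → resp' i j }
        where
        ends : Fin 2 → Fin (size X)
        ends zero    = a
        ends (suc _) = b
        resp' : ∀ i j → T (rel (chain 2) i j) → T (rel X (ends i) (ends j))
        resp' zero (suc zero) _ = r

      link⇒rel : ∀ {Y} (x z : ET.Point Y) → ET.Link x z → T (rel Y (map x zero) (map z zero))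
      link⇒rel {Y} x z (h , h₀ , h₁) =
        subst₂ (λ a b → T (rel Y a b)) (h₀ zero) (h₁ zero) (resp h {zero} {suc zero} _)

theorem15 : ∀ {oP ℓP eP} (Pc : Category oP ℓP eP) (y : Functor 𝓛 Pc) →
    IsFreeConsFinCocompletion 𝓛 Pc y →
    Equivalence Pc 𝓖 × Equivalence Pc 𝓣
theorem15 Pc y free = equivalence-trans (Pc≃𝓣 Pc y free) 𝓣≃𝓖 , Pc≃𝓣 Pc y free
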